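{- Global Boundary Nontrivialization has an $O(\log n)$-factor randomized FPT approximation algorithm for $r$-th homology on $(r+1)$-dimensional complexes $K$, with $\beta$ as the parameter, where $\beta=\beta_{r+1}(K)+1$ and $n$ is the number of simplices in $K$. The algorithm runs in $O\bigl(2^{\beta}\,\beta\, n\cdot\min(n,2^{\beta})\bigr)$ time.
   Context: Homology is simplicial with $\mathbb{Z}_2$ coefficients; $\beta_{r+1}(K)=\dim H_{r+1}(K)$ and $\partial_{r+1}(K)$ is the $(r+1)$-th boundary matrix of $K$. For a set $S$ of $(r+1)$-simplices, $K_S$ is the complex obtained from $K$ by removing $S$ along with all cofaces of simplices in $S$. Global Boundary Nontrivialization (optimization version): given $K$ and $r$, find a set $S$ of $(r+1)$-dimensional simplices of minimum cardinality such that the column space of $\partial_{r+1}(K_S)$ is a strictly smaller subspace of the column space of $\partial_{r+1}(K)$. A randomized FPT approximation algorithm with factor $c$ and parameter $p$ runs in time $f(p)\cdot|I|^{O(1)}$, for a computable function $f$, and with probability at least $1/2$ outputs a solution larger than an optimal solution by a factor of at most $c$. -}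

module Defs where

open import Data.Bool using (Bool; true; false; _∧_; _xor_; if_then_else_)
open import Data.Fin using (Fin; toℕ)
open import Data.Fin.Subset using (Subset; _⊆_; ∣_∣; Nonempty)
open import Data.Fin.Subset.Properties using (_⊆?_; nonempty?; ⊆-trans)
open import Data.List as List using (List; []; _∷_; _++_; length; map; foldr; filter; allFin; concatMap; applyUpTo)
open import Data.List.Membership.Propositional using (_∈_)
open import Data.List.Membership.Propositional.Properties using (∈-filter⁺; ∈-filter⁻)
open import Data.List.Relation.Unary.All as All using (All)
open import Data.List.Relation.Unary.Any as Any using (Any; any?)
open import Data.List.Relation.Unary.Unique.Propositional using (Unique)
import Data.List.Relation.Unary.Unique.Propositional.Properties as Unique
open import Data.Nat using (ℕ; zero; suc; pred; _+_; _*_; _∸_; _^_; _≤_; _⊓_; ⌊_/2⌋; _≡ᵇ_; NonZero)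
open import Data.Nat.Properties using (_≟_)
open import Data.Product using (Σ; ∃; ∃-syntax; Σ-syntax; _×_; _,_; proj₁; proj₂)
open import Data.Vec as Vec using (Vec)
open import Relation.Binary.PropositionalEquality using (_≡_; _≗_)
open import Relation.Nullary using (Dec; ¬_; does)
open import Relation.Nullary.Decidable using (_×-dec_; ¬?)
import Relation.Unary as U

record Complex (v : ℕ) : Set where
  field
    simplices : List (Subset v)
    unique    : Unique simplices
    nonempty  : All Nonempty simplices
    closed    : ∀ {σ τ} → σ ∈ simplices → τ ⊆ σ → Nonempty τ → τ ∈ simplices

open Complex public

module _ {v : ℕ} where

  dim : Subset v → ℕ
  dim σ = pred ∣ σ ∣

  #simplices : Complex v → ℕ
  #simplices K = length (simplices K)

  -- The k-simplices, i.e. those with k + 1 vertices.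
  simplicesOfDim : ℕ → Complex v → List (Subset v)
  simplicesOfDim k K = filter (λ σ → ∣ σ ∣ ≟ suc k) (simplices K)

  HasDimension : Complex v → ℕ → Set
  HasDimension K d = All (λ σ → dim σ ≤ d) (simplices K) × Any (λ σ → dim σ ≡ d) (simplices K)

  Avoids : List (Subset v) → Subset v → Set
  Avoids S σ = ¬ Any (_⊆ σ) S

  avoids? : ∀ S σ → Dec (Avoids S σ)
  avoids? S σ = ¬? (any? (_⊆? σ) S)

  infixl 6 _∖_

  -- Removal of S along with all cofaces of members of S.
  _∖_ : Complex v → List (Subset v) → Complex v
  simplices (K ∖ S) = filter (avoids? S) (simplices K)
  unique    (K ∖ S) = Unique.filter⁺ (avoids? S) (unique K)
  nonempty  (K ∖ S) = All.tabulate λ σ∈ →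
    All.lookup (nonempty K) (proj₁ (∈-filter⁻ (avoids? S) {xs = simplices K} σ∈))
  closed    (K ∖ S) {σ} {τ} σ∈ τ⊆σ τ≠∅ =
    let σ∈K , σ-avoids = ∈-filter⁻ (avoids? S) {xs = simplices K} σ∈ in
    ∈-filter⁺ (avoids? S) (closed K σ∈K τ⊆σ τ≠∅)
      λ s⊆τ → σ-avoids (Any.map {P = _⊆ τ} {Q = _⊆ σ} (λ {s} s⊆ → ⊆-trans {i = s} {τ} {σ} s⊆ τ⊆σ) s⊆τ)

  infix 4 _⋖_ _⋖?_

  _⋖_ : Subset v → Subset v → Set
  τ ⋖ σ = Nonempty τ × τ ⊆ σ × ∣ σ ∣ ≡ suc ∣ τ ∣

  _⋖?_ : (τ σ : Subset v) → Dec (τ ⋖ σ)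
  τ ⋖? σ = nonempty? τ ×-dec (τ ⊆? σ ×-dec (∣ σ ∣ ≟ suc ∣ τ ∣))

-- Sums in ℤ₂ = (Bool, _xor_, _∧_).
⨁ : {A : Set} → List A → (A → Bool) → Bool
⨁ xs f = foldr _xor_ false (map f xs)

-- Chains of every complex on v vertices are extended by zero to all of
-- Subset v, so that column spaces of different complexes lie in one space.
Chain : ℕ → Set
Chain v = Subset v → Bool

module _ {v : ℕ} where

  𝟘 : Chain v
  𝟘 _ = false

  infixl 6 _⊞_

  _⊞_ : Chain v → Chain v → Chain v
  (c ⊞ d) σ = c σ xor d σ

  linComb : ∀ {m} → (Fin m → Bool) → (Fin m → Chain v) → Chain v
  linComb {m} a h σ = ⨁ (allFin m) λ i → a i ∧ h i σ

  IsChain : Complex v → ℕ → Chain v → Set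
  IsChain K k c = ∀ σ → c σ ≡ true → σ ∈ simplicesOfDim k K

  -- The k-th boundary matrix: rows τ, columns σ ∈ simplicesOfDim k K.  The row
  -- of any τ that is not a (k-1)-simplex of K vanishes.
  ∂-entry : Subset v → Subset v → Bool
  ∂-entry τ σ = does (τ ⋖? σ)

  ∂ : Complex v → ℕ → Chain v → Chain v
  ∂ K k c τ = ⨁ (simplicesOfDim k K) λ σ → ∂-entry τ σ ∧ c σ

  ColumnSpace : Complex v → ℕ → Chain v → Set
  ColumnSpace K k y = ∃[ c ] IsChain K k c × y ≗ ∂ K k c

  IsCycle : Complex v → ℕ → Chain v → Set
  IsCycle K k z = IsChain K k z × ∂ K k z ≗ 𝟘

  IsBoundary : Complex v → ℕ → Chain v → Set
  IsBoundary K k = ColumnSpace K (suc k)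

  -- IsBetti K k b : dim H_k(K) = b, witnessed by b cycles whose classes form a
  -- basis of cycles modulo boundaries.
  record IsBetti (K : Complex v) (k b : ℕ) : Set where
    field
      basis       : Fin b → Chain v
      cycles      : ∀ i → IsCycle K k (basis i)
      independent : ∀ a → IsBoundary K k (linComb a basis) → ∀ i → a i ≡ false
      spanning    : ∀ z → IsCycle K k z → ∃[ a ] IsBoundary K k (z ⊞ linComb a basis)

-- Randomized word RAM, programmed in structured form: finitely many registers,
-- an indirectly addressed heap, and a source of fair coin flips.  Every
-- instruction costs one unit of time; no word may exceed the bound W.

Reg : Set
Reg = ℕ

data Expr : Set where
  lit         : ℕ → Expr
  reg load    : Reg → Expr
  add sub mul : Reg → Reg → Expr
  half        : Reg → Expr

infix  6 _≔_
infixr 5 _⨟_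

data Program : Set where
  _≔_    : Reg → Expr → Program
  store  : Reg → Reg → Program
  flip   : Reg → Program
  skip   : Program
  _⨟_    : Program → Program → Program
  ifnz   : Reg → Program → Program → Program
  while  : Reg → Program → Program

record State : Set where
  constructor ⟪_,_,_⟫
  field
    regs  : Reg → ℕ
    heap  : ℕ → ℕ
    coins : List Bool

open State public

_[_↦_] : (ℕ → ℕ) → ℕ → ℕ → (ℕ → ℕ)
(f [ x ↦ n ]) y = if y ≡ᵇ x then n else f y

eval : Expr → State → ℕ
eval (lit n)   s = n
eval (reg x)   s = regs s x
eval (load x)  s = heap s (regs s x)
eval (add x y) s = regs s x + regs s y
eval (sub x y) s = regs s x ∸ regs s y
eval (mul x y) s = regs s x * regs s y
eval (half x)  s = ⌊ regs s x /2⌋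

bit : Bool → ℕ
bit b = if b then 1 else 0

infix 4 _⊢_,_⇓[_]_

-- W ⊢ P , s ⇓[ t ] s′ : with words bounded by W, P started in s halts in s′
-- after exactly t steps.  There is no rule for an overflowing assignment or for
-- a flip without coins left.
data _⊢_,_⇓[_]_ (W : ℕ) : Program → State → ℕ → State → Set where
  ⇓-assign : ∀ {x e s} → eval e s ≤ W →
             W ⊢ x ≔ e , s ⇓[ 1 ] ⟪ regs s [ x ↦ eval e s ] , heap s , coins s ⟫
  ⇓-store  : ∀ {x y s} →
             W ⊢ store x y , s ⇓[ 1 ] ⟪ regs s , heap s [ regs s x ↦ regs s y ] , coins s ⟫
  ⇓-flip   : ∀ {x ρ h b bs} →
             W ⊢ flip x , ⟪ ρ , h , b ∷ bs ⟫ ⇓[ 1 ] ⟪ ρ [ x ↦ bit b ] , h , bs ⟫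
  ⇓-skip   : ∀ {s} → W ⊢ skip , s ⇓[ 1 ] s
  ⇓-seq    : ∀ {P Q s s′ s″ t u} →
             W ⊢ P , s ⇓[ t ] s′ → W ⊢ Q , s′ ⇓[ u ] s″ → W ⊢ P ⨟ Q , s ⇓[ t + u ] s″
  ⇓-then   : ∀ {x P Q s s′ t} → NonZero (regs s x) →
             W ⊢ P , s ⇓[ t ] s′ → W ⊢ ifnz x P Q , s ⇓[ suc t ] s′
  ⇓-else   : ∀ {x P Q s s′ t} → regs s x ≡ 0 →
             W ⊢ Q , s ⇓[ t ] s′ → W ⊢ ifnz x P Q , s ⇓[ suc t ] s′
  ⇓-loop   : ∀ {x P s s′ s″ t u} → NonZero (regs s x) →
             W ⊢ P , s ⇓[ t ] s′ → W ⊢ while x P , s′ ⇓[ u ] s″ →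
             W ⊢ while x P , s ⇓[ suc (t + u) ] s″
  ⇓-exit   : ∀ {x P s} → regs s x ≡ 0 → W ⊢ while x P , s ⇓[ 1 ] s

nth : List ℕ → ℕ → ℕ
nth []       _       = 0
nth (x ∷ xs) zero    = x
nth (x ∷ xs) (suc i) = nth xs i

initial : List ℕ → List Bool → State
initial input bs = ⟪ (λ _ → 0) , nth input , bs ⟫

-- On halting, register 0 holds the address and register 1 the length of the
-- output.
output : State → List ℕ
output s = applyUpTo (λ i → heap s (regs s 0 + i)) (regs s 1)

Computable : (ℕ → ℕ) → Set
Computable f = ∃[ P ] ∀ k → ∃[ W ] ∃[ t ] ∃[ s ]
  (W ⊢ P , initial (k ∷ []) [] ⇓[ t ] s) × output s ≡ f k ∷ []

-- Solutions are words, and the cost of a solution is its length.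
record MinProblem : Set₁ where
  field
    Instance   : Set
    encode     : Instance → List ℕ
    IsSolution : Instance → List ℕ → Set

  size : Instance → ℕ
  size I = length (encode I)

  IsOptimal : Instance → List ℕ → Set
  IsOptimal I S = IsSolution I S × (∀ S′ → IsSolution I S′ → length S ≤ length S′)

  IsApproximation : Instance → ℕ → List ℕ → Set
  IsApproximation I c S =
    IsSolution I S × (∀ S* → IsOptimal I S* → length S ≤ c * length S*)

module _ (Π : MinProblem) where
  open MinProblem Π

  -- A tape of R coins is long enough for P on input I, and on every tape P
  -- halts within T steps.
  HaltsWithin : Program → Instance → (W T R : ℕ) → Set
  HaltsWithin P I W T R = ∀ (ω : Vec Bool R) → ∃[ t ] ∃[ s ]
    (W ⊢ P , initial (encode I) (Vec.toList ω) ⇓[ t ] s) × t ≤ T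

  -- At least half of all tapes of R coins lead to a c-approximate solution.
  SucceedsWithProb≥½ : Program → Instance → (W R c : ℕ) → Set
  SucceedsWithProb≥½ P I W R c = Σ[ good ∈ List (Vec Bool R) ]
    Unique good × 2 ^ R ≤ 2 * length good ×
    All (λ ω → ∃[ t ] ∃[ s ]
          (W ⊢ P , initial (encode I) (Vec.toList ω) ⇓[ t ] s) ×
          IsApproximation I c (output s))
        good

  record IsRandomizedFPTApprox (p c : Instance → ℕ) (P : Program) : Set where
    field
      f            : ℕ → ℕ
      f-computable : Computable f
      k            : ℕ

    bound : Instance → ℕ
    bound I = f (p I) * size I ^ k

    field
      correct : ∀ I → ∃[ R ]
        HaltsWithin P I (bound I) (bound I) R ×
        SucceedsWithProb≥½ P I (bound I) R (c I)

  -- Running time O(g) on a machine with words of O(p + log |I|) bits.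
  RunsInTimeO : (p g : Instance → ℕ) → Program → Set
  RunsInTimeO p g P = ∃[ C ] ∀ I → ∃[ R ]
    HaltsWithin P I ((2 ^ p I * size I) ^ C) (C * g I) R

module _ {v : ℕ} (K : Complex v) where

  simplexAt : Fin (#simplices K) → Subset v
  simplexAt = List.lookup (simplices K)

  facets cofacets : Fin (#simplices K) → List ℕ
  facets   i = map toℕ (filter (λ j → simplexAt j ⋖? simplexAt i) (allFin (#simplices K)))
  cofacets i = map toℕ (filter (λ j → simplexAt i ⋖? simplexAt j) (allFin (#simplices K)))

  -- The Hasse diagram of K, i.e. its boundary matrices stored sparsely both by
  -- columns and by rows.
  encodeComplex : List ℕ
  encodeComplex = #simplices K ∷ concatMap record-of (allFin (#simplices K))
    where
    withLength : List ℕ → List ℕ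
    withLength xs = length xs ∷ xs

    record-of : Fin (#simplices K) → List ℕ
    record-of i = dim (simplexAt i) ∷ withLength (facets i) ++ withLength (cofacets i)

  -- S is duplicate-free, so length S is its cardinality.
  IsNontrivializing : ℕ → List (Subset v) → Set
  IsNontrivializing r S =
    Unique S ×
    All (_∈ simplicesOfDim (suc r) K) S ×
    ColumnSpace (K ∖ S) (suc r) U.⊂ ColumnSpace K (suc r)

-- An (r+1)-dimensional complex K together with r.  The Betti number is
-- recorded only to define the parameter; it is not part of the encoding.
record GBNInstance : Set where
  field
    {vertices} : ℕ
    K          : Complex vertices
    r          : ℕ
    dimension  : HasDimension K (suc r)
    betti      : ℕ
    isBetti    : IsBetti K (suc r) betti

  β : ℕ
  β = betti + 1

  n : ℕ
  n = #simplices K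

open GBNInstance public using (β; n)

-- A solution is output as a list of indices into the list of simplices.
GlobalBoundaryNontrivialization : MinProblem
GlobalBoundaryNontrivialization = record
  { Instance   = GBNInstance
  ; encode     = λ I → let open GBNInstance I in r ∷ encodeComplex K
  ; IsSolution = λ I out → let open GBNInstance I in
      ∃[ is ] out ≡ map toℕ is × IsNontrivializing K r (map (simplexAt K) is)
  }

{-# OPTIONS --safe #-}
module Submission where

-- Over ℤ₂ the column space of the boundary matrix loses dimension under removal
-- of a set S of (r+1)-simplices exactly when S contains the support of a nonzero
-- coboundary of r-simplices.  One direction is the adjunction between boundary
-- and coboundary (support-nontrivializing).  The other is duality: if no nonzero
-- coboundary is supported in S, then a functional that annihilates the surviving
-- columns annihilates all columns, so every column lies in the span of the
-- surviving ones (separate, columnSpace-unchanged).  The problem therefore asks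
-- for a nonzero vector of least weight in the row space of the boundary matrix.
--
-- Call an r-simplex with at least one cofacet a row.  Let q be the number of
-- rows, m that of (r+1)-simplices, n that of all simplices, and b the Betti
-- number, so that β = b + 1.  The algorithm flips no coins:
--
-- * It scans the input for the row with the fewest cofacets.  If there are at
--   most 2 (r + 2) of them, they are the output.  Every solution is nonempty, and
--   2 ^ (r + 2) ≤ n + 1 because an (r+1)-simplex has 2 ^ (r + 2) - 1 nonempty
--   faces (2^card≤1+#simplices), so this is an O(log n)-approximation.
--
-- * Otherwise it computes the coboundaries of all 2 ^ q sets of rows and outputs
--   the smallest nonempty support, which is an optimal solution
--   (solution-bound).  This case is affordable: as every row has more than
--   2 (r + 2) entries and every column has r + 2, double counting gives 2 q ≤ m,
--   and m ≤ q + b by rank and nullity (rank-nullity), whence q ≤ b (rows-few).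
--
-- One coboundary takes O((q + 1) n) steps, since a row has at most n cofacets.
-- The total is at most 100 · 2 ^ β β n steps, hence also at most
-- 100 · 4 ^ β times the length of the input.
--
-- The machine is handled by a program logic for total correctness with time
-- bounds (Run): a state is represented by the list of its register contents and
-- its heap, up to pointwise equality, so that straight-line code is executed
-- symbolically and only loops need invariants.

open import Data.Bool using (Bool; true; false; _∧_; _xor_; not)
open import Data.Bool.Properties using (xor-assoc; xor-comm; xor-same; xor-identityʳ; ∧-distribˡ-xor; ∧-distribʳ-xor; ∧-comm; ∧-assoc; ∧-zeroʳ; ∧-identityʳ)
import Data.Bool.Properties as Bool
open import Data.Empty using (⊥-elim)
open import Data.Fin using (Fin; zero; suc; toℕ; punchIn)
import Data.Fin.Properties as Fin
open import Data.Fin.Subset using (Subset; inside; outside; _⊆_; ∣_∣; Nonempty; ⊥)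
open import Data.Fin.Subset.Properties using (drop-∷-⊆; out⊆; in⊆in; p⊆q⇒∣p∣≤∣q∣; nonempty?; Empty-unique; ⊆-refl; x∈p⇒∣p-x∣<∣p∣)
open import Data.List using (List; []; _∷_; _++_; length; map; filter; allFin; concatMap; tabulate; lookup; applyUpTo)
open import Data.List.Membership.Propositional using (_∈_; lose; find)
open import Data.List.Membership.Propositional.Properties using (∈-allFin; ∈-filter⁺; ∈-filter⁻; ∈-map⁺; ∈-map⁻; ∈-lookup; ∈-∃++; ∈-++⁻; ∈-++⁺ˡ; ∈-++⁺ʳ)
open import Data.List.Properties using (length-++; length-map; length-filter; length-tabulate; filter-accept; filter-reject; filter-≐; filter-none; filter-some)
open import Data.List.Relation.Unary.All as All using (All; []; _∷_)
open import Data.List.Relation.Unary.AllPairs using ([]; _∷_)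
open import Data.List.Relation.Unary.Any as Any using (Any; here; there; index)
open import Data.List.Relation.Unary.Any.Properties using (lookup-index)
open import Data.List.Relation.Unary.Unique.Propositional using (Unique)
import Data.List.Relation.Unary.Unique.Propositional.Properties as Unique
open import Data.Nat using (ℕ; zero; suc; pred; _+_; _*_; _∸_; _^_; _≤_; _<_; _⊓_; _≡ᵇ_; ⌊_/2⌋; NonZero; z≤n; s≤s; >-nonZero; >-nonZero⁻¹; ≢-nonZero; ≢-nonZero⁻¹)
open import Data.Nat.ListAction using (sum)
open import Data.Nat.Logarithm using (⌊log₂_⌋; ⌊log₂⌋-mono-≤; ⌊log₂[2^n]⌋≡n)
open import Data.Nat.Properties
open import Data.Nat.Tactic.RingSolver using (solve-∀)
open import Data.Product using (∃-syntax; _×_; _,_; proj₁; proj₂)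
open import Data.Sum using (_⊎_; inj₁; inj₂; [_,_]′)
open import Data.Unit using (⊤; tt)
open import Data.Vec as Vec using (Vec; []; _∷_; here; there)
open import Data.Vec.Functional using (insertAt)
open import Data.Vec.Functional.Properties using (insertAt-lookup; insertAt-punchIn)
open import Data.Vec.Properties using (≡-dec)
open import Function using (_∘_; case_of_)
open import Relation.Binary.Definitions using (DecidableEquality)
open import Relation.Binary.PropositionalEquality using (_≡_; _≢_; refl; sym; trans; cong; cong₂; subst; _≗_; module ≡-Reasoning)
open import Relation.Nullary using (Dec; yes; no; does; ¬_)
open import Relation.Nullary.Decidable using (dec-true; dec-false; _×-dec_)
import Relation.Unary as U
open import Defs

private variable
  A B : Set
  v k m : ℕ

-- Sums over ℤ₂

xor-interchange : ∀ a b c d → (a xor b) xor (c xor d) ≡ (a xor c) xor (b xor d)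
xor-interchange a b c d = begin
  (a xor b) xor (c xor d) ≡⟨ xor-assoc a b (c xor d) ⟩
  a xor (b xor (c xor d)) ≡⟨ cong (a xor_) (xor-assoc b c d) ⟨
  a xor ((b xor c) xor d) ≡⟨ cong (λ e → a xor (e xor d)) (xor-comm b c) ⟩
  a xor ((c xor b) xor d) ≡⟨ cong (a xor_) (xor-assoc c b d) ⟩
  a xor (c xor (b xor d)) ≡⟨ xor-assoc a c (b xor d) ⟨
  (a xor c) xor (b xor d) ∎
  where open ≡-Reasoning

⨁-cong : ∀ (xs : List A) {f g : A → Bool} → (∀ {x} → x ∈ xs → f x ≡ g x) → ⨁ xs f ≡ ⨁ xs g
⨁-cong []       eq = refl
⨁-cong (x ∷ xs) eq = cong₂ _xor_ (eq (here refl)) (⨁-cong xs (eq ∘ there))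

⨁-zero : ∀ (xs : List A) {f : A → Bool} → (∀ {x} → x ∈ xs → f x ≡ false) → ⨁ xs f ≡ false
⨁-zero []       eq = refl
⨁-zero (x ∷ xs) eq = cong₂ _xor_ (eq (here refl)) (⨁-zero xs (eq ∘ there))

⨁-xor : ∀ (xs : List A) (f g : A → Bool) → ⨁ xs (λ x → f x xor g x) ≡ ⨁ xs f xor ⨁ xs g
⨁-xor []       f g = refl
⨁-xor (x ∷ xs) f g = trans (cong ((f x xor g x) xor_) (⨁-xor xs f g))
                           (xor-interchange (f x) (g x) (⨁ xs f) (⨁ xs g))

⨁-∧ˡ : ∀ (xs : List A) b (f : A → Bool) → ⨁ xs (λ x → b ∧ f x) ≡ b ∧ ⨁ xs f
⨁-∧ˡ xs true  f = refl
⨁-∧ˡ xs false f = ⨁-zero xs {λ _ → false} λ _ → refl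

⨁-∧ʳ : ∀ (xs : List A) (f : A → Bool) b → ⨁ xs (λ x → f x ∧ b) ≡ ⨁ xs f ∧ b
⨁-∧ʳ xs f b = begin
  ⨁ xs (λ x → f x ∧ b) ≡⟨ ⨁-cong xs (λ {x} _ → ∧-comm (f x) b) ⟩
  ⨁ xs (λ x → b ∧ f x) ≡⟨ ⨁-∧ˡ xs b f ⟩
  b ∧ ⨁ xs f           ≡⟨ ∧-comm b _ ⟩
  ⨁ xs f ∧ b           ∎
  where open ≡-Reasoning

⨁-swap : ∀ (xs : List A) (ys : List B) (f : A → B → Bool) →
         ⨁ xs (λ x → ⨁ ys (f x)) ≡ ⨁ ys (λ y → ⨁ xs (λ x → f x y))
⨁-swap []       ys f = sym (⨁-zero ys {λ _ → false} λ _ → refl)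
⨁-swap (x ∷ xs) ys f = trans (cong (⨁ ys (f x) xor_) (⨁-swap xs ys f))
                             (sym (⨁-xor ys (f x) (λ y → ⨁ xs (λ x → f x y))))

⨁-filter : ∀ {P : A → Set} (P? : U.Decidable P) xs (f : A → Bool) →
           ⨁ (filter P? xs) f ≡ ⨁ xs (λ x → does (P? x) ∧ f x)
⨁-filter P? []       f = refl
⨁-filter P? (x ∷ xs) f with does (P? x)
... | true  = cong (f x xor_) (⨁-filter P? xs f)
... | false = ⨁-filter P? xs f

-- Terms outside the filter may be dropped when they vanish.
⨁-filter-support : ∀ {P : A → Set} (P? : U.Decidable P) xs (f : A → Bool) →
                   (∀ {x} → x ∈ xs → f x ≡ true → P x) → ⨁ (filter P? xs) f ≡ ⨁ xs f
⨁-filter-support P? xs f supp = trans (⨁-filter P? xs f) (⨁-cong xs term)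
  where
  term : ∀ {x} → x ∈ xs → does (P? x) ∧ f x ≡ f x
  term {x} x∈ with f x in fx
  ... | false = ∧-zeroʳ _
  ... | true  = trans (∧-identityʳ _) (dec-true (P? x) (supp x∈ fx))

⨁-indicator : ∀ (_≟_ : DecidableEquality A) {xs} → Unique xs → ∀ {x} → x ∈ xs → (g : A → Bool) →
              ⨁ xs (λ y → does (y ≟ x) ∧ g y) ≡ g x
⨁-indicator _≟_ {x ∷ xs} u (here refl) g = begin
  (does (x ≟ x) ∧ g x) xor rest ≡⟨ cong (λ b → (b ∧ g x) xor rest) (dec-true (x ≟ x) refl) ⟩
  g x xor rest                  ≡⟨ cong (g x xor_) (⨁-zero xs other) ⟩
  g x xor false                 ≡⟨ xor-identityʳ (g x) ⟩
  g x                           ∎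
  where
  open ≡-Reasoning
  rest = ⨁ xs (λ y → does (y ≟ x) ∧ g y)
  other : ∀ {y} → y ∈ xs → does (y ≟ x) ∧ g y ≡ false
  other {y} y∈ = cong (_∧ g y) (dec-false (y ≟ x) λ { refl → Unique.Unique[x∷xs]⇒x∉xs u y∈ })
⨁-indicator _≟_ {x ∷ xs} u@(_ ∷ u′) {y} (there y∈) g =
  trans (cong (λ b → (b ∧ g x) xor ⨁ xs (λ z → does (z ≟ y) ∧ g z)) (dec-false (x ≟ y) λ { refl → Unique.Unique[x∷xs]⇒x∉xs u y∈ }))
        (⨁-indicator _≟_ u′ y∈ g)

⨁-true : ∀ (xs : List A) (f : A → Bool) → ⨁ xs f ≡ true → ∃[ x ] x ∈ xs × f x ≡ true
⨁-true (x ∷ xs) f eq with f x in fx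
... | true  = x , here refl , fx
... | false with y , y∈ , fy ← ⨁-true xs f eq = y , there y∈ , fy

⨁-tabulate : ∀ {n} (t : A → B) (g : Fin n → A) (f : B → Bool) →
             ⨁ (tabulate (t ∘ g)) f ≡ ⨁ (tabulate g) (f ∘ t)
⨁-tabulate {n = zero}  t g f = refl
⨁-tabulate {n = suc n} t g f = cong (f (t (g zero)) xor_) (⨁-tabulate t (g ∘ suc) f)

⨁-allFin-suc : ∀ n (f : Fin (suc n) → Bool) →
               ⨁ (allFin (suc n)) f ≡ f zero xor ⨁ (allFin n) (f ∘ suc)
⨁-allFin-suc n f = cong (f zero xor_) (⨁-tabulate suc (λ i → i) f)

-- A duplicate-free list contained in another one is no longer than it.
unique-length : ∀ {xs ys : List A} → Unique xs → (∀ {x} → x ∈ xs → x ∈ ys) → length xs ≤ length ys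
unique-length {xs = []}     _        _   = z≤n
unique-length {xs = x ∷ xs} u@(_ ∷ u′) incl with as , bs , refl ← ∈-∃++ (incl (here refl)) =
  ≤-trans (s≤s (unique-length u′ incl′)) (≤-reflexive len)
  where
  incl′ : ∀ {y} → y ∈ xs → y ∈ as ++ bs
  incl′ y∈ with ∈-++⁻ as (incl (there y∈))
  ... | inj₁ y∈as         = ∈-++⁺ˡ y∈as
  ... | inj₂ (here refl)  = ⊥-elim (Unique.Unique[x∷xs]⇒x∉xs u y∈)
  ... | inj₂ (there y∈bs) = ∈-++⁺ʳ as y∈bs
  len : suc (length (as ++ bs)) ≡ length (as ++ x ∷ bs)
  len = trans (cong suc (length-++ as)) (trans (sym (+-suc (length as) (length bs))) (sym (length-++ as)))

-- Separation of a vector from a subspace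

find-true : (xs : List A) (f : A → Bool) →
         (∀ {x} → x ∈ xs → f x ≡ false) ⊎ (∃[ x ] x ∈ xs × f x ≡ true)
find-true []       f = inj₁ λ ()
find-true (x ∷ xs) f with f x in fx | find-true xs f
... | true  | _                     = inj₂ (x , here refl , fx)
... | false | inj₂ (y , y∈ , fy)    = inj₂ (y , there y∈ , fy)
... | false | inj₁ none             = inj₁ λ { (here refl) → fx ; (there y∈) → none y∈ }

module Separation {I J : Set} (_≟_ : DecidableEquality I) {rows : List I} (rows! : Unique rows)
                  (g : J → I → Bool) where

  -- The pairing of a covector with a vector, both indexed by the rows.
  ⟨_,_⟩ : (I → Bool) → (I → Bool) → Bool
  ⟨ a , y ⟩ = ⨁ rows λ i → a i ∧ y i

  pairing-xorˡ : ∀ a a′ y → ⟨ (λ i → a i xor a′ i) , y ⟩ ≡ ⟨ a , y ⟩ xor ⟨ a′ , y ⟩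
  pairing-xorˡ a a′ y = trans (⨁-cong rows λ {i} _ → ∧-distribʳ-xor (y i) (a i) (a′ i)) (⨁-xor rows _ _)

  pairing-xorʳ : ∀ a y y′ → ⟨ a , (λ i → y i xor y′ i) ⟩ ≡ ⟨ a , y ⟩ xor ⟨ a , y′ ⟩
  pairing-xorʳ a y y′ = trans (⨁-cong rows λ {i} _ → ∧-distribˡ-xor (a i) (y i) (y′ i)) (⨁-xor rows _ _)

  -- On the rows, y is a sum of members of the family g indexed by entries of js;
  -- an index may be repeated.
  InSpan : List J → (I → Bool) → Set
  InSpan js y = ∃[ ss ] All (_∈ js) ss × (∀ {i} → i ∈ rows → y i ≡ ⨁ ss (λ j → g j i))

  -- Some covector annihilates the family but not y.
  Separated : List J → (I → Bool) → Set
  Separated js y = ∃[ a ] (∀ {j} → j ∈ js → ⟨ a , g j ⟩ ≡ false) × ⟨ a , y ⟩ ≡ true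

  -- A vector outside the span of a family is detected by a covector that
  -- annihilates the family.  By induction on the family: if the covector a
  -- found for js does not annihilate g j, then y is replaced by y + g j, and a
  -- covector for that vector is corrected by a if necessary.
  separate : ∀ js y → InSpan js y ⊎ Separated js y
  separate [] y with find-true rows y
  ... | inj₁ none         = inj₁ ([] , [] , none)
  ... | inj₂ (i , i∈ , yi) =
    inj₂ ((λ j → does (j ≟ i)) , (λ ()) , trans (⨁-indicator _≟_ rows! i∈ y) yi)
  separate (j ∷ js) y with separate js y
  ... | inj₁ (ss , ss⊆ , eq)  = inj₁ (ss , All.map there ss⊆ , eq)
  ... | inj₂ (a , a⊥js , ay) with ⟨ a , g j ⟩ in agj
  ...   | false = inj₂ (a , (λ { (here refl) → agj ; (there j∈) → a⊥js j∈ }) , ay)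
  ...   | true with separate js (λ i → g j i xor y i)
  ...     | inj₁ (ss , ss⊆ , eq) = inj₁ (j ∷ ss , here refl ∷ All.map there ss⊆ , eq′)
    where
    eq′ : ∀ {i} → i ∈ rows → y i ≡ g j i xor ⨁ ss (λ j → g j i)
    eq′ {i} i∈ = begin
      y i                               ≡⟨ cong (_xor y i) (xor-same (g j i)) ⟨
      (g j i xor g j i) xor y i         ≡⟨ xor-assoc (g j i) (g j i) (y i) ⟩
      g j i xor (g j i xor y i)         ≡⟨ cong (g j i xor_) (eq i∈) ⟩
      g j i xor ⨁ ss (λ j → g j i)      ∎
      where open ≡-Reasoning
  ...     | inj₂ (a′ , a′⊥js , a′gjy) with ⟨ a′ , g j ⟩ in a′gj | trans (sym (pairing-xorʳ a′ (g j) y)) a′gjy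
  ...       | false | a′y = inj₂ (a′ , (λ { (here refl) → a′gj ; (there j∈) → a′⊥js j∈ }) , a′y)
  ...       | true  | a′y = inj₂ ((λ i → a i xor a′ i) , sum⊥ , trans (pairing-xorˡ a a′ y) (cong₂ _xor_ ay (not-true a′y)))
    where
    not-true : ∀ {b} → not b ≡ true → b ≡ false
    not-true {false} _ = refl
    -- Neither a nor a′ annihilates g j, so their sum does.
    sum⊥ : ∀ {j′} → j′ ∈ j ∷ js → ⟨ (λ i → a i xor a′ i) , g j′ ⟩ ≡ false
    sum⊥ {j′} j′∈ = trans (pairing-xorˡ a a′ (g j′)) (lemma j′∈)
      where
      lemma : j′ ∈ j ∷ js → ⟨ a , g j′ ⟩ xor ⟨ a′ , g j′ ⟩ ≡ false
      lemma (here refl) = cong₂ _xor_ agj a′gj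
      lemma (there j∈)  = cong₂ _xor_ (a⊥js j∈) (a′⊥js j∈)

-- Rank

⨁-punchIn : ∀ (i : Fin (suc k)) f → ⨁ (allFin (suc k)) f ≡ f i xor ⨁ (allFin k) (f ∘ punchIn i)
⨁-punchIn {k}     zero    f = ⨁-allFin-suc k f
⨁-punchIn {suc k} (suc i) f = begin
  ⨁ (allFin (suc (suc k))) f
    ≡⟨ ⨁-allFin-suc (suc k) f ⟩
  f zero xor ⨁ (allFin (suc k)) (f ∘ suc)
    ≡⟨ cong (f zero xor_) (⨁-punchIn i (f ∘ suc)) ⟩
  f zero xor (f (suc i) xor rest)
    ≡⟨ xor-assoc (f zero) _ _ ⟨
  (f zero xor f (suc i)) xor rest
    ≡⟨ cong (_xor rest) (xor-comm (f zero) _) ⟩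
  (f (suc i) xor f zero) xor rest
    ≡⟨ xor-assoc (f (suc i)) _ _ ⟩
  f (suc i) xor (f zero xor rest)
    ≡⟨ cong (f (suc i) xor_) (⨁-allFin-suc k (f ∘ punchIn (suc i))) ⟨
  f (suc i) xor ⨁ (allFin (suc k)) (f ∘ punchIn (suc i)) ∎
  where
  open ≡-Reasoning
  rest = ⨁ (allFin k) (f ∘ suc ∘ punchIn i)

-- The linear combination of the family w with coefficients a.
combination : (Fin m → Bool) → (Fin m → A → Bool) → A → Bool
combination {m} a w x = ⨁ (allFin m) λ i → a i ∧ w i x

-- Linear independence over ℤ₂.
Independent : (Fin m → A → Bool) → Set
Independent w = ∀ a → (∀ x → combination a w x ≡ false) → ∀ i → a i ≡ false

-- Linearity of a functional over ℤ₂.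
Additive : ((A → Bool) → Bool) → Set
Additive φ = ∀ u v → φ (λ x → u x xor v x) ≡ φ u xor φ v

-- With closure under sums, a predicate can be carried through elimination.
SumClosed : ((A → Bool) → Set) → Set
SumClosed Z = ∀ {u v} → Z u → Z v → Z (λ x → u x xor v x)

-- One linear condition costs at most one dimension: a vector on which it fails
-- is added to the other vectors on which it fails.
impose : (φ : (A → Bool) → Bool) → Additive φ → (Z : (A → Bool) → Set) → SumClosed Z →
         (w : Fin (suc k) → A → Bool) → Independent w → (∀ i → Z (w i)) →
         ∃[ w′ ] Independent {k} w′ × (∀ i → Z (w′ i) × φ (w′ i) ≡ false)
impose {A} {k} φ φ+ Z Z+ w ind Zw with find-true (allFin (suc k)) (φ ∘ w)
... | inj₁ none = w ∘ suc , ind′ , λ i → Zw (suc i) , none (∈-allFin (suc i))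
  where
  ind′ : Independent (w ∘ suc)
  ind′ a eq i = ind a′ (λ x → trans (⨁-allFin-suc k (λ i → a′ i ∧ w i x)) (eq x)) (suc i)
    where
    a′ : Fin (suc k) → Bool
    a′ zero    = false
    a′ (suc i) = a i
... | inj₂ (p , _ , φp) = (λ j → reduce (w (punchIn p j))) , ind′ , λ j → reduce-kernel (Zw (punchIn p j))
  where
  reduce : (A → Bool) → A → Bool
  reduce u with φ u
  ... | true  = λ x → w p x xor u x
  ... | false = u

  reduce-value : ∀ u x → reduce u x ≡ (φ u ∧ w p x) xor u x
  reduce-value u x with φ u
  ... | true  = refl
  ... | false = refl

  reduce-kernel : ∀ {u} → Z u → Z (reduce u) × φ (reduce u) ≡ false
  reduce-kernel {u} Zu with φ u in φu
  ... | true  = Z+ (Zw p) Zu , trans (φ+ (w p) u) (cong₂ _xor_ φp φu)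
  ... | false = Zu , φu

  ind′ : Independent (λ j → reduce (w (punchIn p j)))
  ind′ a eq j = trans (sym (insertAt-punchIn a p c j)) (ind (insertAt a p c) vanish (punchIn p j))
    where
    -- The coefficient that the pivot w p receives in total.
    c = ⨁ (allFin k) λ j → a j ∧ φ (w (punchIn p j))
    vanish : ∀ x → combination (insertAt a p c) w x ≡ false
    vanish x = begin
      ⨁ (allFin (suc k)) (λ i → insertAt a p c i ∧ w i x)
        ≡⟨ ⨁-punchIn p (λ i → insertAt a p c i ∧ w i x) ⟩
      (insertAt a p c p ∧ w p x) xor ⨁ (allFin k) (λ j → insertAt a p c (punchIn p j) ∧ w (punchIn p j) x)
        ≡⟨ cong₂ (λ b s → (b ∧ w p x) xor s) (insertAt-lookup a p c)
             (⨁-cong (allFin k) λ {j} _ → cong (_∧ w (punchIn p j) x) (insertAt-punchIn a p c j)) ⟩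
      (c ∧ w p x) xor ⨁ (allFin k) (λ j → a j ∧ w (punchIn p j) x)
        ≡⟨ cong (_xor ⨁ (allFin k) (λ j → a j ∧ w (punchIn p j) x)) (⨁-∧ʳ (allFin k) _ (w p x)) ⟨
      ⨁ (allFin k) (λ j → (a j ∧ φ (w (punchIn p j))) ∧ w p x) xor ⨁ (allFin k) (λ j → a j ∧ w (punchIn p j) x)
        ≡⟨ ⨁-xor (allFin k) _ _ ⟨
      ⨁ (allFin k) (λ j → ((a j ∧ φ (w (punchIn p j))) ∧ w p x) xor (a j ∧ w (punchIn p j) x))
        ≡⟨ ⨁-cong (allFin k) (λ {j} _ → term j) ⟩
      ⨁ (allFin k) (λ j → a j ∧ reduce (w (punchIn p j)) x)
        ≡⟨ eq x ⟩
      false ∎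
      where
      open ≡-Reasoning
      term : ∀ j → ((a j ∧ φ (w (punchIn p j))) ∧ w p x) xor (a j ∧ w (punchIn p j) x)
                 ≡ a j ∧ reduce (w (punchIn p j)) x
      term j = trans (cong (_xor (a j ∧ w (punchIn p j) x)) (∧-assoc (a j) _ _))
        (trans (sym (∧-distribˡ-xor (a j) _ _)) (cong (a j ∧_) (sym (reduce-value (w (punchIn p j)) x))))

-- Imposing the functionals indexed by fs leaves at least m - length fs
-- independent vectors.
impose-all : ∀ {F : Set} (φ : F → (A → Bool) → Bool) → (∀ f → Additive (φ f)) → (fs : List F) →
             (Z : (A → Bool) → Set) → SumClosed Z → m ≡ length fs + k →
             (w : Fin m → A → Bool) → Independent w → (∀ i → Z (w i)) →
             ∃[ w′ ] Independent {k} w′ × (∀ i → Z (w′ i) × (∀ {f} → f ∈ fs → φ f (w′ i) ≡ false))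
impose-all φ φ+ []       Z Z+ refl w ind Zw = w , ind , λ i → Zw i , λ ()
impose-all φ φ+ (f ∷ fs) Z Z+ refl w ind Zw
  with w₁ , ind₁ , Zw₁ ← impose (φ f) (φ+ f) Z Z+ w ind Zw
  with w₂ , ind₂ , Zw₂ ← impose-all φ φ+ fs (λ u → Z u × φ f u ≡ false)
         (λ {u} {v} (Zu , fu) (Zv , fv) → Z+ Zu Zv , trans (φ+ f u v) (cong₂ _xor_ fu fv)) refl w₁ ind₁ Zw₁
  = w₂ , ind₂ , λ i → proj₁ (proj₁ (Zw₂ i)) ,
      λ { (here refl) → proj₂ (proj₁ (Zw₂ i)) ; (there f∈) → proj₂ (Zw₂ i) f∈ }

-- Rank–nullity as an inequality.  If m > length fs + b, then imposing fs leaves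
-- more than b independent vectors in the span of z; imposing the vanishing of
-- all b coefficients on their coefficient vectors leaves an independent family
-- of zero vectors, which is absurd.
rank-nullity : ∀ {F : Set} {b} (φ : F → (A → Bool) → Bool) → (∀ f → Additive (φ f)) → (fs : List F) →
               (Z : (A → Bool) → Set) → SumClosed Z →
               (w : Fin m → A → Bool) → Independent w → (∀ i → Z (w i)) →
               (z : Fin b → A → Bool) →
               (∀ u → Z u → (∀ {f} → f ∈ fs → φ f u ≡ false) → ∃[ a ] u ≗ combination a z) →
               m ≤ length fs + b
rank-nullity {m = m} {b = b} φ φ+ fs Z Z+ w ind Zw z span with m ≤? length fs + b
... | yes m≤ = m≤
... | no  m≰ with k , eq ← m≤n⇒∃[o]m+o≡n (≰⇒> m≰)
  with w₁ , ind₁ , Zw₁ ← impose-all {k = b + suc k} φ φ+ fs Z Z+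
         (trans (sym eq) (trans (sym (+-suc (length fs + b) k)) (+-assoc (length fs) b (suc k)))) w ind Zw
  = ⊥-elim (absurd (indᶜ (λ _ → true) (λ j → ⨁-zero (allFin (suc k)) λ {i} _ → proj₂ (cᶜ i) (∈-allFin j)) zero))
  where
  coefficients : Fin (b + suc k) → Fin b → Bool
  coefficients i = proj₁ (span (w₁ i) (proj₁ (Zw₁ i)) (proj₂ (Zw₁ i)))

  expand : ∀ i → w₁ i ≗ combination (coefficients i) z
  expand i = proj₂ (span (w₁ i) (proj₁ (Zw₁ i)) (proj₂ (Zw₁ i)))

  independent : Independent coefficients
  independent x vanish = ind₁ x λ s → begin
    ⨁ (allFin (b + suc k)) (λ i → x i ∧ w₁ i s)
      ≡⟨ ⨁-cong (allFin (b + suc k)) (λ {i} _ → trans (cong (x i ∧_) (expand i s)) (sym (⨁-∧ˡ (allFin b) (x i) _))) ⟩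
    ⨁ (allFin (b + suc k)) (λ i → ⨁ (allFin b) (λ j → x i ∧ (coefficients i j ∧ z j s)))
      ≡⟨ ⨁-swap (allFin (b + suc k)) (allFin b) (λ i j → x i ∧ (coefficients i j ∧ z j s)) ⟩
    ⨁ (allFin b) (λ j → ⨁ (allFin (b + suc k)) (λ i → x i ∧ (coefficients i j ∧ z j s)))
      ≡⟨ ⨁-zero (allFin b) (λ {j} _ → trans
           (⨁-cong (allFin (b + suc k)) λ {i} _ → sym (∧-assoc (x i) (coefficients i j) (z j s)))
           (trans (⨁-∧ʳ (allFin (b + suc k)) (λ i → x i ∧ coefficients i j) (z j s)) (cong (_∧ z j s) (vanish j)))) ⟩
    false ∎
    where open ≡-Reasoning

  reduced = impose-all {k = suc k} (λ j u → u j) (λ j u v → refl) (allFin b) (λ _ → ⊤) _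
              (cong (_+ suc k) (sym (length-tabulate (λ i → i)))) coefficients independent _
  indᶜ = proj₁ (proj₂ reduced)
  cᶜ = proj₂ (proj₂ reduced)
  absurd : true ≡ false → _
  absurd ()

-- Faces and facets

⊆-card⇒≡ : ∀ {σ τ : Subset v} → σ ⊆ τ → ∣ σ ∣ ≡ ∣ τ ∣ → σ ≡ τ
⊆-card⇒≡ {σ = []}          {[]}          _ _  = refl
⊆-card⇒≡ {σ = outside ∷ _} {outside ∷ _} p eq = cong (outside ∷_) (⊆-card⇒≡ (drop-∷-⊆ p) eq)
⊆-card⇒≡ {σ = inside ∷ _}  {inside ∷ _}  p eq = cong (inside ∷_) (⊆-card⇒≡ (drop-∷-⊆ p) (suc-injective eq))
⊆-card⇒≡ {σ = outside ∷ σ} {inside ∷ τ}  p eq =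
  ⊥-elim (1+n≰n (subst (_≤ ∣ τ ∣) eq (p⊆q⇒∣p∣≤∣q∣ (drop-∷-⊆ p))))
⊆-card⇒≡ {σ = inside ∷ _}  {outside ∷ _} p eq with () ← p here

-- All subsets of σ, including the empty one.
faces : Subset v → List (Subset v)
faces []            = [] ∷ []
faces (outside ∷ σ) = map (outside ∷_) (faces σ)
faces (inside ∷ σ)  = map (outside ∷_) (faces σ) ++ map (inside ∷_) (faces σ)

faces-⊆ : ∀ (σ : Subset v) {τ} → τ ∈ faces σ → τ ⊆ σ
faces-⊆ []            (here refl) = λ x → x
faces-⊆ (outside ∷ σ) τ∈ with _ , τ′∈ , refl ← ∈-map⁻ _ τ∈ = out⊆ (faces-⊆ σ τ′∈)
faces-⊆ (inside ∷ σ)  τ∈ with ∈-++⁻ (map (outside ∷_) (faces σ)) τ∈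
... | inj₁ τ∈₁ with _ , τ′∈ , refl ← ∈-map⁻ _ τ∈₁ = out⊆ (faces-⊆ σ τ′∈)
... | inj₂ τ∈₂ with _ , τ′∈ , refl ← ∈-map⁻ _ τ∈₂ = in⊆in (faces-⊆ σ τ′∈)

faces-unique : ∀ (σ : Subset v) → Unique (faces σ)
faces-unique []            = [] ∷ []
faces-unique (outside ∷ σ) = Unique.map⁺ (λ { refl → refl }) (faces-unique σ)
faces-unique (inside ∷ σ)  =
  Unique.++⁺ (Unique.map⁺ (λ { refl → refl }) (faces-unique σ)) (Unique.map⁺ (λ { refl → refl }) (faces-unique σ))
    λ { (τ∈₁ , τ∈₂) → disjoint (∈-map⁻ _ τ∈₁) (∈-map⁻ _ τ∈₂) }
  where
  disjoint : ∀ {τ} → ∃[ ρ ] ρ ∈ faces σ × τ ≡ outside ∷ ρ → ∃[ ρ ] ρ ∈ faces σ × τ ≡ inside ∷ ρ → Data.Empty.⊥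
  disjoint (_ , _ , refl) (_ , _ , ())

length-faces : ∀ (σ : Subset v) → length (faces σ) ≡ 2 ^ ∣ σ ∣
length-faces []            = refl
length-faces (outside ∷ σ) = trans (length-map _ (faces σ)) (length-faces σ)
length-faces (inside ∷ σ)  = trans (length-++ (map (outside ∷_) (faces σ)))
  (cong₂ _+_ (trans (length-map _ (faces σ)) (length-faces σ))
             (trans (trans (length-map _ (faces σ)) (length-faces σ)) (sym (+-identityʳ _))))

-- A simplex has exponentially many faces, and all but the empty one belong to
-- the complex.
2^card≤1+#simplices : ∀ (K : Complex v) {σ} → σ ∈ simplices K → 2 ^ ∣ σ ∣ ≤ suc (#simplices K)
2^card≤1+#simplices K {σ} σ∈ =
  subst (_≤ suc (#simplices K)) (length-faces σ) (unique-length {ys = ⊥ ∷ simplices K} (faces-unique σ) face∈)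
  where
  face∈ : ∀ {τ} → τ ∈ faces σ → τ ∈ ⊥ ∷ simplices K
  face∈ {τ} τ∈ with nonempty? τ
  ... | yes τ≠∅ = there (closed K σ∈ (faces-⊆ σ τ∈) τ≠∅)
  ... | no  τ=∅ = here (Empty-unique τ=∅)

-- The subsets of σ with one vertex less.
maximalFaces : Subset v → List (Subset v)
maximalFaces []            = []
maximalFaces (outside ∷ σ) = map (outside ∷_) (maximalFaces σ)
maximalFaces (inside ∷ σ)  = (outside ∷ σ) ∷ map (inside ∷_) (maximalFaces σ)

length-maximalFaces : ∀ (σ : Subset v) → length (maximalFaces σ) ≡ ∣ σ ∣
length-maximalFaces []            = refl
length-maximalFaces (outside ∷ σ) = trans (length-map _ (maximalFaces σ)) (length-maximalFaces σ)
length-maximalFaces (inside ∷ σ)  = cong suc (trans (length-map _ (maximalFaces σ)) (length-maximalFaces σ))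

∈-maximalFaces : ∀ {σ τ : Subset v} → τ ⊆ σ → ∣ σ ∣ ≡ suc ∣ τ ∣ → τ ∈ maximalFaces σ
∈-maximalFaces {σ = outside ∷ σ} {outside ∷ τ} p eq = ∈-map⁺ _ (∈-maximalFaces (drop-∷-⊆ p) eq)
∈-maximalFaces {σ = outside ∷ σ} {inside ∷ τ}  p eq with () ← p here
∈-maximalFaces {σ = inside ∷ σ}  {outside ∷ τ} p eq =
  here (cong (outside ∷_) (⊆-card⇒≡ (drop-∷-⊆ p) (sym (suc-injective eq))))
∈-maximalFaces {σ = inside ∷ σ}  {inside ∷ τ}  p eq =
  there (∈-map⁺ _ (∈-maximalFaces (drop-∷-⊆ p) (suc-injective eq)))

facet-exists : ∀ {σ : Subset v} → Nonempty σ → ∃[ τ ] τ ⊆ σ × ∣ σ ∣ ≡ suc ∣ τ ∣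
facet-exists {σ = inside ∷ σ}  _ = outside ∷ σ , out⊆ ⊆-refl , refl
facet-exists {σ = outside ∷ σ} (suc x , there x∈) with τ , τ⊆ , card ← facet-exists (x , x∈) =
  outside ∷ τ , out⊆ τ⊆ , card

infix 4 _≟ˢ_
_≟ˢ_ : DecidableEquality (Subset v)
_≟ˢ_ = ≡-dec Bool._≟_

does-true : ∀ {P : Set} (P? : Dec P) → does P? ≡ true → P
does-true (yes p) _ = p

lookup-injective : ∀ {xs : List A} → Unique xs → ∀ {i j} → lookup xs i ≡ lookup xs j → i ≡ j
lookup-injective {xs = x ∷ xs} u {zero}  {zero}  eq = refl
lookup-injective {xs = x ∷ xs} u {zero}  {suc j} eq =
  ⊥-elim (Unique.Unique[x∷xs]⇒x∉xs u (subst (_∈ xs) (sym eq) (∈-lookup j)))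
lookup-injective {xs = x ∷ xs} u {suc i} {zero}  eq =
  ⊥-elim (Unique.Unique[x∷xs]⇒x∉xs u (subst (_∈ xs) eq (∈-lookup i)))
lookup-injective {xs = x ∷ xs} (_ ∷ u) {suc i} {suc j} eq = cong suc (lookup-injective u eq)

-- Counting

sum-swap : ∀ (xs : List A) (ys : List B) (f : A → B → ℕ) →
           sum (map (λ x → sum (map (f x) ys)) xs) ≡ sum (map (λ y → sum (map (λ x → f x y) xs)) ys)
sum-swap [] [] f = refl
sum-swap [] (y ∷ ys) f = sum-swap [] ys f
sum-swap (x ∷ xs) ys f = trans (cong (sum (map (f x) ys) +_) (sum-swap xs ys f)) (sym (sum-+ ys))
  where
  regroup : ∀ a b c d → (a + b) + (c + d) ≡ (a + c) + (b + d)
  regroup = solve-∀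
  g = λ y → sum (map (λ x → f x y) xs)
  sum-+ : ∀ zs → sum (map (λ y → f x y + g y) zs) ≡ sum (map (f x) zs) + sum (map g zs)
  sum-+ []       = refl
  sum-+ (z ∷ zs) = trans (cong ((f x z + g z) +_) (sum-+ zs)) (regroup (f x z) (g z) _ _)

length-filter-sum : ∀ {P : A → Set} (P? : U.Decidable P) xs → length (filter P? xs) ≡ sum (map (bit ∘ does ∘ P?) xs)
length-filter-sum P? []       = refl
length-filter-sum P? (x ∷ xs) with does (P? x)
... | true  = cong suc (length-filter-sum P? xs)
... | false = length-filter-sum P? xs

sum-≥ : ∀ c {xs : List A} (f : A → ℕ) → (∀ {x} → x ∈ xs → c ≤ f x) → length xs * c ≤ sum (map f xs)
sum-≥ c {[]}     f _ = z≤n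
sum-≥ c {x ∷ xs} f h = +-mono-≤ (h (here refl)) (sum-≥ c f (h ∘ there))

sum-≤ : ∀ c {xs : List A} (f : A → ℕ) → (∀ {x} → x ∈ xs → f x ≤ c) → sum (map f xs) ≤ length xs * c
sum-≤ c {[]}     f _ = z≤n
sum-≤ c {x ∷ xs} f h = +-mono-≤ (h (here refl)) (sum-≤ c f (h ∘ there))

-- Double counting of a relation in which each member of xs has at least c
-- partners in ys, and each member of ys at most d partners in xs.
double-count : ∀ {R : A → B → Set} (R? : ∀ x y → Dec (R x y)) c d {xs ys} →
               (∀ {x} → x ∈ xs → c ≤ length (filter (R? x) ys)) →
               (∀ {y} → y ∈ ys → length (filter (λ x → R? x y) xs) ≤ d) →
               length xs * c ≤ length ys * d
double-count R? c d {xs} {ys} lower upper = begin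
  length xs * c                                        ≤⟨ sum-≥ c (λ x → sum (map (λ y → bit (does (R? x y))) ys)) (λ {x} x∈ → ≤-trans (lower x∈) (≤-reflexive (length-filter-sum (R? x) ys))) ⟩
  sum (map (λ x → sum (map (λ y → bit (does (R? x y))) ys)) xs) ≡⟨ sum-swap xs ys _ ⟩
  sum (map (λ y → sum (map (λ x → bit (does (R? x y))) xs)) ys) ≤⟨ sum-≤ d (λ y → sum (map (λ x → bit (does (R? x y))) xs)) (λ {y} y∈ → ≤-trans (≤-reflexive (sym (length-filter-sum (λ x → R? x y) xs))) (upper y∈)) ⟩
  length ys * d                                        ∎
  where open ≤-Reasoning

-- Subsets of a list, numbered in binary

-- The parity of x, computed without division.
lowBit : ℕ → ℕ
lowBit x = x ∸ (⌊ x /2⌋ + ⌊ x /2⌋)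

-- The sublist of the entries whose position is a set binary digit of x.
chosen : ℕ → List A → List A
chosen x []       = []
chosen x (i ∷ is) with lowBit x
... | zero  = chosen ⌊ x /2⌋ is
... | suc _ = i ∷ chosen ⌊ x /2⌋ is

chosen-even : ∀ x (i : A) is → lowBit x ≡ 0 → chosen x (i ∷ is) ≡ chosen ⌊ x /2⌋ is
chosen-even x i is eq with lowBit x
chosen-even x i is refl | zero = refl

chosen-odd : ∀ x (i : A) is {b} → lowBit x ≡ suc b → chosen x (i ∷ is) ≡ i ∷ chosen ⌊ x /2⌋ is
chosen-odd x i is eq with lowBit x
chosen-odd x i is refl | suc _ = refl

chosen-⊆ : ∀ x (is : List A) {i} → i ∈ chosen x is → i ∈ is
chosen-⊆ x (j ∷ is) i∈ with lowBit x
... | zero = there (chosen-⊆ ⌊ x /2⌋ is i∈)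
chosen-⊆ x (j ∷ is) (here refl) | suc _ = here refl
chosen-⊆ x (j ∷ is) (there i∈)  | suc _ = there (chosen-⊆ ⌊ x /2⌋ is i∈)

-- Every indicator function is realized by some number.
choose : ∀ (a : A → Bool) is → ∃[ x ] x < 2 ^ length is ×
         (∀ g → ⨁ (chosen x is) g ≡ ⨁ is (λ i → a i ∧ g i))
choose a [] = 0 , s≤s z≤n , λ g → refl
choose a (i ∷ is) with y , y< , eq ← choose a is | a i
... | false = y + y , subst (y + y <_) (cong (2 ^ length is +_) (sym (+-identityʳ _))) (+-mono-< y< y<) , eq′
  where
  eq′ : ∀ g → ⨁ (chosen (y + y) (i ∷ is)) g ≡ ⨁ is (λ i → a i ∧ g i)
  eq′ g = trans (cong (λ js → ⨁ js g) (trans (chosen-even (y + y) i is low) (cong (λ z → chosen z is) (sym halved)))) (eq g)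
    where
    halved : y ≡ ⌊ y + y /2⌋
    halved = n≡⌊n+n/2⌋ y
    low : lowBit (y + y) ≡ 0
    low = trans (cong (λ z → y + y ∸ (z + z)) (sym halved)) (n∸n≡0 (y + y))
... | true  = suc (y + y) , bound , eq′
  where
  bound : suc (y + y) < 2 ^ length (i ∷ is)
  bound = subst (suc (suc (y + y)) ≤_) (cong (2 ^ length is +_) (sym (+-identityʳ _)))
            (≤-trans (≤-reflexive (cong suc (sym (+-suc y y)))) (+-mono-≤ y< y<))
  eq′ : ∀ g → ⨁ (chosen (suc (y + y)) (i ∷ is)) g ≡ g i xor ⨁ is (λ i → a i ∧ g i)
  eq′ g = trans (cong (λ js → ⨁ js g) (trans (chosen-odd (suc (y + y)) i is low) (cong (λ z → i ∷ chosen z is) (sym halved)))) (cong (g i xor_) (eq g))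
    where
    halved : y ≡ ⌊ suc (y + y) /2⌋
    halved = n≡⌈n+n/2⌉ y
    low : lowBit (suc (y + y)) ≡ 1
    low = trans (cong (λ z → suc (y + y) ∸ (z + z)) (sym halved)) (m+n∸n≡m 1 (y + y))

-- Coboundaries

nonempty⇒card>0 : ∀ {σ : Subset v} → Nonempty σ → 0 < ∣ σ ∣
nonempty⇒card>0 (x , x∈) = ≤-trans (s≤s z≤n) (x∈p⇒∣p-x∣<∣p∣ x∈)

∈-simplicesOfDim⁻ : ∀ {k} {K : Complex v} {σ} → σ ∈ simplicesOfDim k K → σ ∈ simplices K × ∣ σ ∣ ≡ suc k
∈-simplicesOfDim⁻ {K = K} = ∈-filter⁻ (λ σ → ∣ σ ∣ ≟ suc _) {xs = simplices K}

∈-simplicesOfDim⁺ : ∀ {k} {K : Complex v} {σ} → σ ∈ simplices K → ∣ σ ∣ ≡ suc k → σ ∈ simplicesOfDim k K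
∈-simplicesOfDim⁺ = ∈-filter⁺ (λ σ → ∣ σ ∣ ≟ suc _)

∧-true : ∀ {a b} → a ∧ b ≡ true → a ≡ true × b ≡ true
∧-true {true} {true} _ = refl , refl

module _ {v : ℕ} (K : Complex v) where

  -- The boundary as a sum over all simplices, whatever their dimension.
  ∂-total : ∀ {k c} → IsChain K k c → ∀ τ → ∂ K k c τ ≡ ⨁ (simplices K) (λ σ → ∂-entry τ σ ∧ c σ)
  ∂-total {k} {c} chain τ = ⨁-filter-support (λ σ → ∣ σ ∣ ≟ suc k) (simplices K) (λ σ → ∂-entry τ σ ∧ c σ)
    λ {σ} _ eq → proj₂ (∈-simplicesOfDim⁻ {K = K} (chain σ (proj₂ (∧-true eq))))

  indicator-chain : ∀ {k σ} → σ ∈ simplicesOfDim k K → IsChain K k (λ ρ → does (ρ ≟ˢ σ))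
  indicator-chain {σ = σ} σ∈ ρ eq = subst (_∈ _) (sym (does-true (ρ ≟ˢ σ) eq)) σ∈

  module _ (S : List (Subset v)) where

    ∖-∈⁻ : ∀ {k σ} → σ ∈ simplicesOfDim k (K ∖ S) → σ ∈ simplicesOfDim k K × Avoids S σ
    ∖-∈⁻ σ∈ with σ∈K∖S , card ← ∈-simplicesOfDim⁻ {K = K ∖ S} σ∈
      with σ∈K , avoids ← ∈-filter⁻ (avoids? S) {xs = simplices K} σ∈K∖S
      = ∈-simplicesOfDim⁺ {K = K} σ∈K card , avoids

    -- Removing k-simplices removes no other k-simplices.
    ∖-∈⁺ : ∀ {k σ} → All (_∈ simplicesOfDim k K) S → σ ∈ simplicesOfDim k K → ¬ σ ∈ S → σ ∈ simplicesOfDim k (K ∖ S)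
    ∖-∈⁺ {k} {σ} S⊆ σ∈ σ∉S with σ∈K , card ← ∈-simplicesOfDim⁻ {K = K} σ∈ =
      ∈-simplicesOfDim⁺ {K = K ∖ S} (∈-filter⁺ (avoids? S) σ∈K avoids) card
      where
      equal : ∀ {s} → s ∈ S → s ⊆ σ → σ ≡ s
      equal {s} s∈ s⊆σ = sym (⊆-card⇒≡ s⊆σ (trans (proj₂ (∈-simplicesOfDim⁻ {K = K} (All.lookup S⊆ s∈))) (sym card)))
      avoids : Avoids S σ
      avoids s⊆σ = σ∉S (go S (λ s∈ → s∈) s⊆σ)
        where
        go : ∀ ss → (∀ {s} → s ∈ ss → s ∈ S) → Any (_⊆ σ) ss → σ ∈ S
        go (s ∷ _) ⊆S (here p)  = subst (_∈ S) (sym (equal (⊆S (here refl)) p)) (⊆S (here refl))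
        go (_ ∷ _) ⊆S (there p) = go _ (⊆S ∘ there) p

    columnSpace-∖ : ∀ k → ColumnSpace (K ∖ S) k U.⊆ ColumnSpace K k
    columnSpace-∖ k (c , chain , y≗) = c , chainK , λ τ → trans (y≗ τ) (begin
      ∂ (K ∖ S) k c τ
        ≡⟨ ∂-total-∖ τ ⟩
      ⨁ (filter (avoids? S) (simplices K)) (λ σ → ∂-entry τ σ ∧ c σ)
        ≡⟨ ⨁-filter-support (avoids? S) (simplices K) (λ σ → ∂-entry τ σ ∧ c σ) (λ {σ} _ eq → proj₂ (∖-∈⁻ (chain σ (proj₂ (∧-true eq))))) ⟩
      ⨁ (simplices K) (λ σ → ∂-entry τ σ ∧ c σ)
        ≡⟨ ∂-total chainK τ ⟨
      ∂ K k c τ ∎)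
      where
      open ≡-Reasoning
      chainK : IsChain K k c
      chainK σ eq = proj₁ (∖-∈⁻ (chain σ eq))
      ∂-total-∖ : ∀ τ → ∂ (K ∖ S) k c τ ≡ ⨁ (simplices (K ∖ S)) (λ σ → ∂-entry τ σ ∧ c σ)
      ∂-total-∖ τ = ⨁-filter-support (λ σ → ∣ σ ∣ ≟ suc k) (simplices (K ∖ S)) (λ σ → ∂-entry τ σ ∧ c σ)
        λ {σ} _ eq → proj₂ (∈-simplicesOfDim⁻ {K = K ∖ S} (chain σ (proj₂ (∧-true eq))))

module Coboundary {v : ℕ} (K : Complex v) (r : ℕ) where

  -- A simplex is represented by its position in the list of simplices.
  Index : Set
  Index = Fin (#simplices K)

  σ[_] : Index → Subset v
  σ[_] = simplexAt K

  indices : List Index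
  indices = allFin (#simplices K)

  σ-injective : ∀ {i j} → σ[ i ] ≡ σ[ j ] → i ≡ j
  σ-injective = lookup-injective (unique K)

  σ∈K : ∀ i → σ[ i ] ∈ simplices K
  σ∈K i = ∈-lookup i

  indexOf : ∀ {σ} → σ ∈ simplices K → ∃[ i ] σ ≡ σ[ i ]
  indexOf σ∈ = index σ∈ , lookup-index σ∈

  -- The (r+1)-simplices.
  top : List (Subset v)
  top = simplicesOfDim (suc r) K

  -- The cofacets of a simplex, before conversion of the indices to words.
  cofacetIndices : Index → List Index
  cofacetIndices i = filter (λ j → σ[ i ] ⋖? σ[ j ]) indices

  -- The r-simplices with at least one cofacet: the nonzero rows of the
  -- boundary matrix.
  IsRow : Index → Set
  IsRow i = dim σ[ i ] ≡ r × NonZero (length (cofacetIndices i))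

  isRow? : ∀ i → Dec (IsRow i)
  isRow? i = (dim σ[ i ] ≟ r) ×-dec nonZero? (length (cofacetIndices i))

  rows : List Index
  rows = filter isRow? indices

  rows! : Unique rows
  rows! = Unique.filter⁺ isRow? (Unique.allFin⁺ _)

  ∈-rows⁻ : ∀ {i} → i ∈ rows → IsRow i
  ∈-rows⁻ i∈ = proj₂ (∈-filter⁻ isRow? {xs = indices} i∈)

  ∈-rows⁺ : ∀ {i} → IsRow i → i ∈ rows
  ∈-rows⁺ {i} = ∈-filter⁺ isRow? (∈-allFin i)

  card-dim : ∀ {i k} → dim σ[ i ] ≡ k → ∣ σ[ i ] ∣ ≡ suc k
  card-dim {i} refl = sym (suc-pred _ {{>-nonZero (nonempty⇒card>0 (All.lookup (nonempty K) (σ∈K i)))}})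

  coface-top : ∀ {i j} → dim σ[ i ] ≡ r → σ[ i ] ⋖ σ[ j ] → σ[ j ] ∈ top
  coface-top {j = j} di (_ , _ , card) = ∈-simplicesOfDim⁺ {K = K} (σ∈K j) (trans card (cong suc (card-dim di)))

  -- Every facet of an (r+1)-simplex is a row.
  facet-row : ∀ {σ τ} → σ ∈ top → τ ⋖ σ → ∃[ i ] i ∈ rows × τ ≡ σ[ i ]
  facet-row {σ} {τ} σ∈ τ⋖σ@(τ≠∅ , τ⊆σ , card) with σ∈K , cardσ ← ∈-simplicesOfDim⁻ {K = K} σ∈
    with j , refl ← indexOf σ∈K
    with i , refl ← indexOf (closed K σ∈K τ⊆σ τ≠∅)
    = i , ∈-rows⁺ (cong pred (suc-injective (trans (sym card) cardσ)) ,
                   >-nonZero (filter-some (λ j → σ[ i ] ⋖? σ[ j ]) (lose (∈-allFin j) τ⋖σ))) , refl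

  entry-row : ∀ {σ τ} → σ ∈ top → ∂-entry τ σ ≡ true → ∃[ i ] i ∈ rows × τ ≡ σ[ i ]
  entry-row {σ} {τ} σ∈ eq = facet-row σ∈ (does-true (τ ⋖? σ) eq)

  -- A set of vertices is a row, or its row in the boundary matrix vanishes.
  row-or-not : ∀ τ → (∃[ i ] i ∈ rows × τ ≡ σ[ i ]) ⊎ (∀ {σ} → σ ∈ top → ∂-entry τ σ ≡ false)
  row-or-not τ with find-true rows (λ i → does (τ ≟ˢ σ[ i ]))
  ... | inj₂ (i , i∈ , eq) = inj₁ (i , i∈ , does-true (τ ≟ˢ σ[ i ]) eq)
  ... | inj₁ none          = inj₂ vanish
    where
    vanish : ∀ {σ} → σ ∈ top → ∂-entry τ σ ≡ false
    vanish {σ} σ∈ with ∂-entry τ σ in eq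
    ... | false = refl
    ... | true with i , i∈ , τ≡ ← entry-row σ∈ eq = case trans (sym (none i∈)) (dec-true (τ ≟ˢ σ[ i ]) τ≡) of λ ()

  -- The coboundary of the sum of the r-simplices listed in A.
  δ : List Index → Subset v → Bool
  δ A σ = ⨁ A λ i → ∂-entry σ[ i ] σ

  -- The (r+1)-simplices in the coboundary, when A consists of rows.
  support : List Index → List Index
  support A = filter (λ j → δ A σ[ j ] Bool.≟ true) indices

  ∈-support⁻ : ∀ {A j} → j ∈ support A → δ A σ[ j ] ≡ true
  ∈-support⁻ {A} j∈ = proj₂ (∈-filter⁻ (λ j → δ A σ[ j ] Bool.≟ true) {xs = indices} j∈)

  ∈-support⁺ : ∀ {A j} → δ A σ[ j ] ≡ true → j ∈ support A
  ∈-support⁺ {A} {j} eq = ∈-filter⁺ (λ j → δ A σ[ j ] Bool.≟ true) (∈-allFin j) eq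

  support-top : ∀ {A} → (∀ {i} → i ∈ A → i ∈ rows) → ∀ {j} → j ∈ support A → σ[ j ] ∈ top
  support-top {A} A⊆ {j} j∈ with i , i∈ , eq ← ⨁-true A _ (∈-support⁻ {A} j∈) =
    coface-top {i} (proj₁ (∈-rows⁻ (A⊆ i∈))) (does-true (σ[ i ] ⋖? σ[ j ]) eq)

  support-singleton : ∀ i → support (i ∷ []) ≡ cofacetIndices i
  support-singleton i = filter-≐ (λ j → δ (i ∷ []) σ[ j ] Bool.≟ true) (λ j → σ[ i ] ⋖? σ[ j ])
    ((λ {j} eq → does-true (σ[ i ] ⋖? σ[ j ]) (trans (sym (xor-identityʳ _)) eq)) ,
     (λ {j} p → trans (xor-identityʳ _) (dec-true (σ[ i ] ⋖? σ[ j ]) p))) indices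

  -- The coboundary is adjoint to the boundary.
  adjoint : ∀ A (L : Complex v) k c → ⨁ A (λ i → ∂ L k c σ[ i ]) ≡ ⨁ (simplicesOfDim k L) (λ σ → δ A σ ∧ c σ)
  adjoint A L k c = trans (⨁-swap A (simplicesOfDim k L) (λ i σ → ∂-entry σ[ i ] σ ∧ c σ))
    (⨁-cong (simplicesOfDim k L) λ {σ} _ → ⨁-∧ʳ A (λ i → ∂-entry σ[ i ] σ) (c σ))

  top! : Unique top
  top! = Unique.filter⁺ (λ σ → ∣ σ ∣ ≟ suc (suc r)) (unique K)

  -- Removing the support of a nonzero coboundary shrinks the column space: the
  -- set of rows A pairs to zero with all surviving columns, but not with those
  -- in the support.
  support-nontrivializing : ∀ A → (∀ {i} → i ∈ A → i ∈ rows) → NonZero (length (support A)) →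
                            IsNontrivializing K r (map σ[_] (support A))
  support-nontrivializing A A⊆ nz =
    Unique.map⁺ σ-injective (Unique.filter⁺ (λ j → δ A σ[ j ] Bool.≟ true) (Unique.allFin⁺ _)) ,
    All.tabulate S⊆top ,
    columnSpace-∖ K S (suc r) , notAll
    where
    S = map σ[_] (support A)
    S⊆top : ∀ {σ} → σ ∈ S → σ ∈ top
    S⊆top σ∈ with j , j∈ , refl ← ∈-map⁻ σ[_] σ∈ = support-top A⊆ j∈

    first : ∀ (js : List Index) → NonZero (length js) → ∃[ j ] j ∈ js
    first (j ∷ _) _ = j , here refl

    j₀ = proj₁ (first (support A) nz)
    j₀∈ = proj₂ (first (support A) nz)
    c₀ : Chain v
    c₀ ρ = does (ρ ≟ˢ σ[ j₀ ])

    notAll : ¬ (ColumnSpace K (suc r) U.⊆ ColumnSpace (K ∖ S) (suc r))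
    notAll incl with c , chain , y≗ ← incl {∂ K (suc r) c₀} (c₀ , indicator-chain K (support-top A⊆ j₀∈) , λ _ → refl) =
      case trans (sym left) (trans (⨁-cong A (λ {i} _ → y≗ σ[ i ])) right) of λ ()
      where
      left : ⨁ A (λ i → ∂ K (suc r) c₀ σ[ i ]) ≡ true
      left = begin
        ⨁ A (λ i → ∂ K (suc r) c₀ σ[ i ])                  ≡⟨ adjoint A K (suc r) c₀ ⟩
        ⨁ top (λ σ → δ A σ ∧ does (σ ≟ˢ σ[ j₀ ]))           ≡⟨ ⨁-cong top (λ {σ} _ → ∧-comm (δ A σ) _) ⟩
        ⨁ top (λ σ → does (σ ≟ˢ σ[ j₀ ]) ∧ δ A σ)           ≡⟨ ⨁-indicator _≟ˢ_ top! (support-top A⊆ j₀∈) (δ A) ⟩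
        δ A σ[ j₀ ]                                         ≡⟨ ∈-support⁻ {A} j₀∈ ⟩
        true                                                ∎
        where open ≡-Reasoning
      survivor : ∀ {σ} → σ ∈ simplicesOfDim (suc r) (K ∖ S) → δ A σ ≡ false
      survivor {σ} σ∈ with δ A σ in eq
      ... | false = refl
      ... | true with σ∈top , avoids ← ∖-∈⁻ K S σ∈
        with j , refl ← indexOf (proj₁ (∈-simplicesOfDim⁻ {K = K} σ∈top)) =
        ⊥-elim (avoids (lose (∈-map⁺ σ[_] (∈-support⁺ {A} eq)) ⊆-refl))
      right : ⨁ A (λ i → ∂ (K ∖ S) (suc r) c σ[ i ]) ≡ false
      right = trans (adjoint A (K ∖ S) (suc r) c)
        (⨁-zero (simplicesOfDim (suc r) (K ∖ S)) λ {σ} σ∈ → cong (_∧ c σ) (survivor σ∈))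

  open Separation {J = Subset v} Fin._≟_ rows! (λ σ i → ∂-entry σ[ i ] σ)

  -- The coboundary of a set of rows that is given by its indicator function.
  δᶜ : (Index → Bool) → Subset v → Bool
  δᶜ a σ = ⟨ a , (λ i → ∂-entry σ[ i ] σ) ⟩

  -- If no nonzero coboundary is supported in S, then removing S leaves the
  -- column space unchanged.
  columnSpace-unchanged : ∀ S → All (_∈ top) S →
    (∀ a → (∀ {σ} → σ ∈ top → δᶜ a σ ≡ true → σ ∈ S) → ∀ {σ} → σ ∈ top → δᶜ a σ ≡ false) →
    ColumnSpace K (suc r) U.⊆ ColumnSpace (K ∖ S) (suc r)
  columnSpace-unchanged S S⊆ none {y} (c , chain , y≗) = from (separate rest (λ i → y σ[ i ]))
    where
    rest = simplicesOfDim (suc r) (K ∖ S)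
    rest! : Unique rest
    rest! = Unique.filter⁺ (λ σ → ∣ σ ∣ ≟ suc (suc r)) (unique (K ∖ S))

    from : InSpan rest (λ i → y σ[ i ]) ⊎ Separated rest (λ i → y σ[ i ]) → ColumnSpace (K ∖ S) (suc r) y
    from (inj₁ (ss , ss⊆ , span)) = c′ , chain′ , eq
      where
      c′ : Chain v
      c′ σ = ⨁ ss λ s → does (σ ≟ˢ s)
      chain′ : IsChain (K ∖ S) (suc r) c′
      chain′ σ eq with s , s∈ , σs ← ⨁-true ss _ eq =
        subst (_∈ rest) (sym (does-true (σ ≟ˢ s) σs)) (All.lookup ss⊆ s∈)
      eq : ∀ τ → y τ ≡ ∂ (K ∖ S) (suc r) c′ τ
      eq τ with row-or-not τ
      ... | inj₂ zeros = trans (y≗ τ) (trans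
              (⨁-zero top λ {σ} σ∈ → cong (_∧ c σ) (zeros σ∈))
              (sym (⨁-zero rest λ {σ} σ∈ → cong (_∧ c′ σ) (zeros (proj₁ (∖-∈⁻ K S σ∈))))))
      ... | inj₁ (i , i∈ , refl) = begin
              y σ[ i ]
                ≡⟨ span i∈ ⟩
              ⨁ ss (λ s → ∂-entry σ[ i ] s)
                ≡⟨ ⨁-cong ss (λ s∈ → ⨁-indicator _≟ˢ_ rest! (All.lookup ss⊆ s∈) (∂-entry σ[ i ])) ⟨
              ⨁ ss (λ s → ⨁ rest (λ σ → does (σ ≟ˢ s) ∧ ∂-entry σ[ i ] σ))
                ≡⟨ ⨁-swap ss rest (λ s σ → does (σ ≟ˢ s) ∧ ∂-entry σ[ i ] σ) ⟩
              ⨁ rest (λ σ → ⨁ ss (λ s → does (σ ≟ˢ s) ∧ ∂-entry σ[ i ] σ))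
                ≡⟨ ⨁-cong rest (λ {σ} _ → trans (⨁-∧ʳ ss (λ s → does (σ ≟ˢ s)) (∂-entry σ[ i ] σ)) (∧-comm (c′ σ) _)) ⟩
              ∂ (K ∖ S) (suc r) c′ σ[ i ] ∎
        where open ≡-Reasoning
    from (inj₂ (a , a⊥ , ay)) = case trans (sym ay) zero-pairing of λ ()
      where
      inS : ∀ {σ} → σ ∈ top → δᶜ a σ ≡ true → σ ∈ S
      inS {σ} σ∈ eq with Any.any? (σ ≟ˢ_) S
      ... | yes σ∈S = σ∈S
      ... | no  σ∉S = case trans (sym eq) (a⊥ (∖-∈⁺ K S S⊆ σ∈ σ∉S)) of λ ()
      zero-pairing : ⟨ a , (λ i → y σ[ i ]) ⟩ ≡ false
      zero-pairing = begin
        ⨁ rows (λ i → a i ∧ y σ[ i ])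
          ≡⟨ ⨁-cong rows (λ {i} _ → trans (cong (a i ∧_) (y≗ σ[ i ])) (sym (⨁-∧ˡ top (a i) (λ σ → ∂-entry σ[ i ] σ ∧ c σ)))) ⟩
        ⨁ rows (λ i → ⨁ top (λ σ → a i ∧ (∂-entry σ[ i ] σ ∧ c σ)))
          ≡⟨ ⨁-swap rows top (λ i σ → a i ∧ (∂-entry σ[ i ] σ ∧ c σ)) ⟩
        ⨁ top (λ σ → ⨁ rows (λ i → a i ∧ (∂-entry σ[ i ] σ ∧ c σ)))
          ≡⟨ ⨁-zero top (λ {σ} σ∈ → trans
               (⨁-cong rows λ {i} _ → sym (∧-assoc (a i) (∂-entry σ[ i ] σ) (c σ)))
               (trans (⨁-∧ʳ rows (λ i → a i ∧ ∂-entry σ[ i ] σ) (c σ)) (cong (_∧ c σ) (none a inS σ∈)))) ⟩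
        false ∎
        where open ≡-Reasoning

  -- A lower bound on the weights of all nonzero coboundaries of sets of rows is a
  -- lower bound on the cardinality of every solution: otherwise a solution would
  -- be too small to contain the support of a nonzero coboundary.
  solution-bound : ∀ {ℓ} → (∀ x → x < 2 ^ length rows → NonZero (length (support (chosen x rows))) →
                            ℓ ≤ length (support (chosen x rows))) →
                   ∀ is → IsNontrivializing K r (map σ[_] is) → ℓ ≤ length is
  solution-bound {ℓ} minimal is (S! , S⊆ , _ , shrinks) with ℓ ≤? length is
  ... | yes ℓ≤ = ℓ≤
  ... | no  ℓ≰ = ⊥-elim (shrinks (columnSpace-unchanged (map σ[_] is) S⊆ none))
    where
    none : ∀ a → (∀ {σ} → σ ∈ top → δᶜ a σ ≡ true → σ ∈ map σ[_] is) → ∀ {σ} → σ ∈ top → δᶜ a σ ≡ false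
    none a inS {σ} σ∈ with x , x< , eq ← choose a rows with nonZero? (length (support (chosen x rows)))
    ... | yes nz = ⊥-elim (ℓ≰ (≤-trans (minimal x x< nz) (unique-length (Unique.filter⁺ _ (Unique.allFin⁺ _)) sup⊆)))
      where
      sup⊆ : ∀ {j} → j ∈ support (chosen x rows) → j ∈ is
      sup⊆ {j} j∈ with i , i∈ , σ≡ ← ∈-map⁻ σ[_] (inS (support-top (chosen-⊆ x rows) j∈)
                             (trans (sym (eq (λ i → ∂-entry σ[ i ] σ[ j ]))) (∈-support⁻ {chosen x rows} j∈)))
        = subst (_∈ is) (sym (σ-injective σ≡)) i∈
    ... | no ¬nz with δᶜ a σ in δσ
    ...   | false = refl
    ...   | true with j , refl ← indexOf (proj₁ (∈-simplicesOfDim⁻ {K = K} σ∈)) =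
      ⊥-elim (¬nz (nonempty-length (∈-support⁺ {chosen x rows} (trans (eq (λ i → ∂-entry σ[ i ] σ[ j ])) δσ))))
      where
      nonempty-length : ∀ {js : List Index} {j} → j ∈ js → NonZero (length js)
      nonempty-length {_ ∷ _} _ = _

  solution-nonempty : ∀ is → IsNontrivializing K r (map σ[_] is) → 1 ≤ length is
  solution-nonempty = solution-bound λ x _ nz → >-nonZero⁻¹ _ {{nz}}

  -- Rank–nullity for the boundary matrix.  There are no (r+2)-simplices, so every
  -- cycle is itself a combination of the b basis cycles.
  #top≤#rows+β : ∀ {b} → All (λ σ → dim σ ≤ suc r) (simplices K) → IsBetti K (suc r) b → length top ≤ length rows + b
  #top≤#rows+β {b} dims B = rank-nullity φ φ-additive rows Z Z-closed unit unit-independent unit-chain basis span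
    where
    open IsBetti B
    φ : Index → Chain v → Bool
    φ i u = ∂ K (suc r) u σ[ i ]
    φ-additive : ∀ i → Additive (φ i)
    φ-additive i u w = trans (⨁-cong top λ {σ} _ → ∧-distribˡ-xor (∂-entry σ[ i ] σ) (u σ) (w σ))
      (⨁-xor top (λ σ → ∂-entry σ[ i ] σ ∧ u σ) (λ σ → ∂-entry σ[ i ] σ ∧ w σ))
    Z : Chain v → Set
    Z = IsChain K (suc r)
    Z-closed : SumClosed Z
    Z-closed {u} {w} Zu Zw σ eq with u σ in uσ
    ... | true  = Zu σ uσ
    ... | false = Zw σ eq
    unit : Fin (length top) → Chain v
    unit i σ = does (σ ≟ˢ lookup top i)
    unit-chain : ∀ i → Z (unit i)
    unit-chain i = indicator-chain K (∈-lookup i)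
    unit-independent : Independent unit
    unit-independent a vanish j = begin
      a j
        ≡⟨ ⨁-indicator Fin._≟_ (Unique.allFin⁺ _) (∈-allFin j) a ⟨
      ⨁ (allFin _) (λ i → does (i Fin.≟ j) ∧ a i)
        ≡⟨ ⨁-cong (allFin _) (λ {i} _ → trans (∧-comm _ (a i)) (cong (a i ∧_) (same i))) ⟩
      combination a unit (lookup top j)
        ≡⟨ vanish (lookup top j) ⟩
      false ∎
      where
      open ≡-Reasoning
      same : ∀ i → does (i Fin.≟ j) ≡ does (lookup top j ≟ˢ lookup top i)
      same i with i Fin.≟ j
      ... | yes refl = sym (dec-true (lookup top i ≟ˢ lookup top i) refl)
      ... | no  i≢j  = sym (dec-false (lookup top j ≟ˢ lookup top i) (i≢j ∘ sym ∘ lookup-injective top!))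
    no-higher : simplicesOfDim (suc (suc r)) K ≡ []
    no-higher = filter-none (λ σ → ∣ σ ∣ ≟ suc (suc (suc r)))
      (All.map (λ d card → 1+n≰n (subst (λ m → pred m ≤ suc r) card d)) dims)
    span : ∀ u → Z u → (∀ {i} → i ∈ rows → φ i u ≡ false) → ∃[ a ] u ≗ combination a basis
    span u Zu φu = expand (spanning u (Zu , cycle))
      where
      cycle : ∂ K (suc r) u ≗ 𝟘
      cycle τ with row-or-not τ
      ... | inj₁ (i , i∈ , refl) = φu i∈
      ... | inj₂ zeros           = ⨁-zero top λ {σ} σ∈ → cong (_∧ u σ) (zeros σ∈)
      xor-zero : ∀ {p q} → p xor q ≡ false → p ≡ q
      xor-zero {false} eq = sym eq
      xor-zero {true} {true} eq = refl
      expand : ∃[ a ] IsBoundary K (suc r) (u ⊞ linComb a basis) → ∃[ a ] u ≗ combination a basis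
      expand (a , d , _ , bd) =
        a , λ τ → xor-zero (trans (bd τ) (cong (λ L → ⨁ L (λ σ → ∂-entry τ σ ∧ d σ)) no-higher))

  -- If every row has more than 2 (r + 2) entries, then double counting of the
  -- incidences leaves at most half as many rows as columns, and the claim follows
  -- by rank–nullity.
  rows-few : ∀ {b} → All (λ σ → dim σ ≤ suc r) (simplices K) → IsBetti K (suc r) b →
             (∀ {i} → i ∈ rows → 2 * (2 + r) < length (cofacetIndices i)) → length rows ≤ b
  rows-few {b} dims B many = +-cancelˡ-≤ q q b (begin
    q + q               ≡⟨ cong (q +_) (+-identityʳ q) ⟨
    2 * q               ≡⟨ *-comm 2 q ⟩
    q * 2               ≤⟨ *-cancelʳ-≤ (q * 2) (length top) (2 + r) count ⟩
    length top          ≤⟨ #top≤#rows+β dims B ⟩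
    q + b               ∎)
    where
    open ≤-Reasoning
    q = length rows
    lower : ∀ {i} → i ∈ rows → 2 * (2 + r) ≤ length (filter (λ σ → σ[ i ] ⋖? σ) top)
    lower {i} i∈ = begin
      2 * (2 + r)                             ≤⟨ <⇒≤ (many i∈) ⟩
      length (cofacetIndices i)               ≡⟨ length-map σ[_] (cofacetIndices i) ⟨
      length (map σ[_] (cofacetIndices i))    ≤⟨ unique-length (Unique.map⁺ σ-injective (Unique.filter⁺ (λ j → σ[ i ] ⋖? σ[ j ]) (Unique.allFin⁺ _))) incl ⟩
      length (filter (λ σ → σ[ i ] ⋖? σ) top) ∎
      where
      incl : ∀ {σ} → σ ∈ map σ[_] (cofacetIndices i) → σ ∈ filter (λ σ → σ[ i ] ⋖? σ) top
      incl σ∈ with j , j∈ , refl ← ∈-map⁻ σ[_] σ∈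
        with _ , i⋖j ← ∈-filter⁻ (λ j → σ[ i ] ⋖? σ[ j ]) {xs = indices} j∈ =
        ∈-filter⁺ (λ σ → σ[ i ] ⋖? σ) (coface-top {i} (proj₁ (∈-rows⁻ i∈)) i⋖j) i⋖j
    upper : ∀ {σ} → σ ∈ top → length (filter (λ i → σ[ i ] ⋖? σ) rows) ≤ 2 + r
    upper {σ} σ∈ = begin
      length fs                    ≡⟨ length-map σ[_] fs ⟨
      length (map σ[_] fs)         ≤⟨ unique-length (Unique.map⁺ σ-injective (Unique.filter⁺ (λ i → σ[ i ] ⋖? σ) rows!)) incl ⟩
      length (maximalFaces σ)      ≡⟨ length-maximalFaces σ ⟩
      ∣ σ ∣                        ≡⟨ proj₂ (∈-simplicesOfDim⁻ {K = K} σ∈) ⟩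
      2 + r                        ∎
      where
      fs = filter (λ i → σ[ i ] ⋖? σ) rows
      incl : ∀ {τ} → τ ∈ map σ[_] fs → τ ∈ maximalFaces σ
      incl τ∈ with i , i∈ , refl ← ∈-map⁻ σ[_] τ∈
        with _ , _ , τ⊆σ , card ← ∈-filter⁻ (λ i → σ[ i ] ⋖? σ) {xs = rows} i∈ = ∈-maximalFaces τ⊆σ card
    count : q * 2 * (2 + r) ≤ length top * (2 + r)
    count = subst (_≤ length top * (2 + r)) (sym (*-assoc q 2 (2 + r)))
      (double-count (λ i σ → σ[ i ] ⋖? σ) (2 * (2 + r)) (2 + r) {rows} {top} lower upper)

-- A program logic for the machine

≡ᵇ-refl : ∀ x → (x ≡ᵇ x) ≡ true
≡ᵇ-refl x = dec-true (x ≟ x) refl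

≡ᵇ-≢ : ∀ {x y} → x ≢ y → (x ≡ᵇ y) ≡ false
≡ᵇ-≢ {x} {y} = dec-false (x ≟ y)

update-same : ∀ h a n → (h [ a ↦ n ]) a ≡ n
update-same h a n rewrite ≡ᵇ-refl a = refl

update-other : ∀ h {a b} n → b ≢ a → (h [ a ↦ n ]) b ≡ h b
update-other h n b≢a rewrite ≡ᵇ-≢ b≢a = refl

update-cong : ∀ {f g} → f ≗ g → ∀ x n → f [ x ↦ n ] ≗ g [ x ↦ n ]
update-cong eq x n y with y ≡ᵇ x
... | true  = refl
... | false = eq y

-- Register contents are given by a list, read by nth, with zeros beyond its end.
write : List ℕ → Reg → ℕ → List ℕ
write []      zero    n = n ∷ []
write []      (suc x) n = 0 ∷ write [] x n
write (_ ∷ v) zero    n = n ∷ v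
write (k ∷ v) (suc x) n = k ∷ write v x n

nth-write : ∀ v x n → nth v [ x ↦ n ] ≗ nth (write v x n)
nth-write []      zero    n zero    = refl
nth-write []      zero    n (suc y) = refl
nth-write []      (suc x) n zero    = refl
nth-write []      (suc x) n (suc y) = nth-write [] x n y
nth-write (_ ∷ v) zero    n zero    = refl
nth-write (_ ∷ v) zero    n (suc y) = refl
nth-write (_ ∷ v) (suc x) n zero    = refl
nth-write (_ ∷ v) (suc x) n (suc y) = nth-write v x n y

-- The state s has register contents v and heap contents h.  Functions are
-- compared pointwise only.
record Represents (s : State) (v : List ℕ) (h : ℕ → ℕ) : Set where
  constructor represents
  field
    regs≗ : regs s ≗ nth v
    heap≗ : heap s ≗ h

-- The value of an expression for register contents v and heap h.
value : Expr → List ℕ → (ℕ → ℕ) → ℕ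
value e v h = eval e ⟪ nth v , h , [] ⟫

eval-value : ∀ e {s v h} → Represents s v h → eval e s ≡ value e v h
eval-value (lit n)   ρ = refl
eval-value (reg x)   (represents r≗ h≗) = r≗ x
eval-value (load x)  {s} (represents r≗ h≗) = trans (cong (heap s) (r≗ x)) (h≗ _)
eval-value (add x y) (represents r≗ h≗) = cong₂ _+_ (r≗ x) (r≗ y)
eval-value (sub x y) (represents r≗ h≗) = cong₂ _∸_ (r≗ x) (r≗ y)
eval-value (mul x y) (represents r≗ h≗) = cong₂ _*_ (r≗ x) (r≗ y)
eval-value (half x)  (represents r≗ h≗) = cong ⌊_/2⌋ (r≗ x)

-- A predicate on register and heap contents.
Assertion : Set₁
Assertion = List ℕ → (ℕ → ℕ) → Set

-- Total correctness with a time bound, for words bounded by W: from every state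
-- represented by v and h, the program P halts within T steps in a state
-- represented by one and the same pair of contents that satisfies Q.  Sequencing
-- is expressed by letting Q assert the correctness of the remaining program.
record Run (W : ℕ) (P : Program) (v : List ℕ) (h : ℕ → ℕ) (Q : Assertion) (T : ℕ) : Set where
  constructor mkRun
  field
    {regs′} : List ℕ
    {heap′} : ℕ → ℕ
    post    : Q regs′ heap′
    exec    : ∀ {s} → Represents s v h →
              ∃[ t ] ∃[ s′ ] (W ⊢ P , s ⇓[ t ] s′) × t ≤ T × Represents s′ regs′ heap′

module _ {W : ℕ} where

  private variable
    P P′  : Program
    Q     : Assertion
    w     : List ℕ
    h     : ℕ → ℕ
    T U c : ℕ
    x y   : Reg
    e     : Expr

  weaken : T ≤ U → Run W P w h Q T → Run W P w h Q U
  weaken T≤U (mkRun post exec) = mkRun post λ ρ →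
    let t , s′ , d , t≤ , ρ′ = exec ρ in t , s′ , d , ≤-trans t≤ T≤U , ρ′

  seq : Run W P w h (λ v′ h′ → Run W P′ v′ h′ Q U) T → Run W (P ⨟ P′) w h Q (T + U)
  seq (mkRun (mkRun post exec′) exec) = mkRun post λ ρ →
    let t , s′ , d , t≤ , ρ′ = exec ρ
        u , s″ , e , u≤ , ρ″ = exec′ ρ′
    in t + u , s″ , ⇓-seq d e , +-mono-≤ t≤ u≤ , ρ″

  assign : value e w h ≡ c → c ≤ W → Q (write w x c) h → Run W (x ≔ e) w h Q 1
  assign {e} {w} {h} {x = x} refl c≤ q = mkRun q λ {s} ρ@(represents r≗ h≗) →
    1 , _ , ⇓-assign (subst (_≤ W) (sym (eval-value e ρ)) c≤) , ≤-refl ,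
    represents (λ k → trans (cong (λ m → (regs s [ x ↦ m ]) k) (eval-value e ρ))
                       (trans (update-cong r≗ x _ k) (nth-write w x _ k))) h≗

  store! : Q w (h [ nth w x ↦ nth w y ]) → Run W (store x y) w h Q 1
  store! {x = x} {y} q = mkRun q λ {s} (represents r≗ h≗) →
    1 , _ , ⇓-store , ≤-refl ,
    represents r≗ λ k → trans (cong₂ (λ a m → (heap s [ a ↦ m ]) k) (r≗ x) (r≗ y)) (update-cong h≗ _ _ k)

  skip! : Q w h → Run W skip w h Q 1
  skip! q = mkRun q λ ρ → 1 , _ , ⇓-skip , ≤-refl , ρ

  -- The frequent special case of seq.
  assign⨟ : value e w h ≡ c → c ≤ W → Run W P (write w x c) h Q T → Run W (x ≔ e ⨟ P) w h Q (suc T)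
  assign⨟ eq c≤ run = seq (assign eq c≤ run)

  then! : NonZero (nth w x) → Run W P w h Q T → Run W (ifnz x P P′) w h Q (suc T)
  then! {x = x} nz (mkRun post exec) = mkRun post λ ρ@(represents r≗ _) →
    let t , s′ , d , t≤ , ρ′ = exec ρ in
    suc t , s′ , ⇓-then (subst NonZero (sym (r≗ x)) nz) d , s≤s t≤ , ρ′

  else! : nth w x ≡ 0 → Run W P′ w h Q T → Run W (ifnz x P P′) w h Q (suc T)
  else! {x = x} z (mkRun post exec) = mkRun post λ ρ@(represents r≗ _) →
    let t , s′ , d , t≤ , ρ′ = exec ρ in
    suc t , s′ , ⇓-else (trans (r≗ x) z) d , s≤s t≤ , ρ′

  loop! : NonZero (nth w x) → Run W P w h (λ v′ h′ → Run W (while x P) v′ h′ Q U) T →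
          Run W (while x P) w h Q (suc (T + U))
  loop! {x = x} nz (mkRun (mkRun post exec′) exec) = mkRun post λ ρ@(represents r≗ _) →
    let t , s′ , d , t≤ , ρ′ = exec ρ
        u , s″ , e , u≤ , ρ″ = exec′ ρ′
    in suc (t + u) , s″ , ⇓-loop (subst NonZero (sym (r≗ x)) nz) d e , s≤s (+-mono-≤ t≤ u≤) , ρ″

  exit! : nth w x ≡ 0 → Q w h → Run W (while x P) w h Q 1
  exit! {x = x} z q = mkRun q λ ρ@(represents r≗ _) → 1 , _ , ⇓-exit (trans (r≗ x) z) , ≤-refl , ρ

-- The words xs are stored from address p on.
Segment : (ℕ → ℕ) → ℕ → List ℕ → Set
Segment h p []       = ⊤
Segment h p (x ∷ xs) = h p ≡ x × Segment h (suc p) xs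

-- The heaps h and h′ agree on the addresses below B.
AgreeBelow : ℕ → (ℕ → ℕ) → (ℕ → ℕ) → Set
AgreeBelow B h h′ = ∀ {a} → a < B → h′ a ≡ h a

segment-++⁻ : ∀ {h} p xs {ys} → Segment h p (xs ++ ys) → Segment h p xs × Segment h (p + length xs) ys
segment-++⁻ {h} p [] {ys} s = tt , subst (λ q → Segment h q ys) (sym (+-identityʳ p)) s
segment-++⁻ {h} p (x ∷ xs) {ys} (eq , s) with s₁ , s₂ ← segment-++⁻ (suc p) xs s =
  (eq , s₁) , subst (λ q → Segment h q ys) (sym (+-suc p (length xs))) s₂

segment-frame : ∀ {h h′ B p} xs → AgreeBelow B h h′ → p + length xs ≤ B → Segment h p xs → Segment h′ p xs
segment-frame []       agree bound _ = tt
segment-frame {B = B} {p} (x ∷ xs) agree bound (eq , s) =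
  trans (agree (≤-trans (s≤s (m≤m+n p _)) bound′)) eq , segment-frame xs agree bound′ s
  where
  bound′ : suc p + length xs ≤ B
  bound′ = subst (_≤ B) (+-suc p (length xs)) bound

segment-intro : ∀ {h} p xs → (∀ k → h (p + k) ≡ nth xs k) → Segment h p xs
segment-intro p []       eq = tt
segment-intro {h} p (x ∷ xs) eq =
  trans (cong h (sym (+-identityʳ p))) (eq 0) ,
  segment-intro (suc p) xs λ k → trans (cong h (sym (+-suc p k))) (eq (suc k))

segment-output : ∀ {h} p xs → Segment h p xs → applyUpTo (λ i → h (p + i)) (length xs) ≡ xs
segment-output p [] _ = refl
segment-output {h} p (x ∷ xs) (eq , s) = cong₂ _∷_ (trans (cong h (+-identityʳ p)) eq)
  (trans (applyUpTo-cong (λ i → cong h (+-suc p i)) (length xs)) (segment-output (suc p) xs s))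
  where
  applyUpTo-cong : ∀ {f g : ℕ → ℕ} → f ≗ g → ∀ n → applyUpTo f n ≡ applyUpTo g n
  applyUpTo-cong f≗g zero    = refl
  applyUpTo-cong f≗g (suc n) = cong₂ _∷_ (f≗g 0) (applyUpTo-cong (f≗g ∘ suc) n)

-- The program
--
-- Register use: 0 and 1 hold the address and length of the best solution so far,
-- 2 a pointer into the input, 3 a loop counter, 4 the number r, 5 the number of
-- simplices, 6 the number of rows, 10 the constant 1, 11 the first unused heap
-- address F, and 12 the current mask.  The others are temporary.

-- Reads the record at the pointer: register 7 becomes zero exactly when the
-- dimension is r, register 8 becomes the number of cofacets, and the pointer
-- moves to the list of cofacets.
nextRecord : Program
nextRecord =
  7 ≔ load 2 ⨟ 2 ≔ add 2 10 ⨟ 8 ≔ load 2 ⨟ 2 ≔ add 2 10 ⨟ 2 ≔ add 2 8 ⨟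
  8 ≔ load 2 ⨟ 2 ≔ add 2 10 ⨟ 9 ≔ sub 7 4 ⨟ 7 ≔ sub 4 7 ⨟ 7 ≔ add 7 9

-- Runs P only if the simplex just read is a row.
ifRow : Program → Program
ifRow P = ifnz 7 skip (ifnz 8 P skip)

-- Handles one record.  P may leave the pointer and register 8 as they are or
-- advance the pointer while decreasing register 8.
visit : Program → Program
visit P = nextRecord ⨟ ifRow P ⨟ 2 ≔ add 2 8 ⨟ 3 ≔ sub 3 10

-- Counts the row, and keeps its list of cofacets if it is the shortest so far.
recordBest : Program
recordBest = 6 ≔ add 6 10 ⨟ 9 ≔ sub 1 8 ⨟ ifnz 9 (1 ≔ reg 8 ⨟ 0 ≔ reg 2) skip

-- Flips the bit at address F + j for the next cofacet j.
toggle : Program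
toggle = 9 ≔ load 2 ⨟ 9 ≔ add 11 9 ⨟ 14 ≔ load 9 ⨟ 14 ≔ sub 10 14 ⨟ store 9 14 ⨟ 2 ≔ add 2 10 ⨟ 8 ≔ sub 8 10

-- Removes the last digit from the mask in register 13, and if it is 1, adds the
-- cofacets of the current row to the parities at F.
toggleChosen : Program
toggleChosen = 9 ≔ half 13 ⨟ 14 ≔ add 9 9 ⨟ 14 ≔ sub 13 14 ⨟ 13 ≔ reg 9 ⨟ ifnz 14 (while 8 toggle) skip

-- Appends one index to the list under construction if its parity is odd.
collect : Program
collect = 9 ≔ add 11 8 ⨟ 9 ≔ load 9 ⨟ ifnz 9 (store 13 8 ⨟ 13 ≔ add 13 10) skip ⨟ 8 ≔ add 8 10 ⨟ 3 ≔ sub 3 10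

-- Compares the new list, of the length in register 8, with the best one so far.
keepBetter : Program
keepBetter = ifnz 8 (9 ≔ sub 1 8 ⨟ ifnz 9 (1 ≔ reg 8 ⨟ 0 ≔ reg 14) skip) skip

-- Computes the coboundary of the set of rows given by the mask.  The parities are
-- stored from F on, and the support after them; as unused heap cells are zero,
-- moving F beyond both spares resetting the parities.
tryMask : Program
tryMask =
  12 ≔ sub 12 10 ⨟ 13 ≔ reg 12 ⨟ 2 ≔ lit 2 ⨟ 3 ≔ reg 5 ⨟ while 3 (visit toggleChosen) ⨟
  14 ≔ add 11 5 ⨟ 13 ≔ reg 14 ⨟ 8 ≔ lit 0 ⨟ 3 ≔ reg 5 ⨟ while 3 collect ⨟
  8 ≔ sub 13 14 ⨟ keepBetter ⨟ 11 ≔ add 14 5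

-- Doubles register 12, once for each row.
double : Program
double = 12 ≔ add 12 12 ⨟ 6 ≔ sub 6 10

-- Tries all masks from 2 ^ q - 1 down to 0.  The first assignment extends the
-- list of registers.
enumerate : Program
enumerate = 14 ≔ lit 0 ⨟ 11 ≔ reg 2 ⨟ 12 ≔ lit 1 ⨟ while 6 double ⨟ while 12 tryMask

-- The scan starts with the length n + 1, which exceeds every number of cofacets,
-- in place of a best solution.  Register 9 finally compares the length found
-- with 2 (r + 2).
algorithm : Program
algorithm =
  10 ≔ lit 1 ⨟ 4 ≔ load 9 ⨟ 5 ≔ load 10 ⨟ 2 ≔ lit 2 ⨟ 3 ≔ reg 5 ⨟ 1 ≔ add 5 10 ⨟ while 3 (visit recordBest) ⨟
  9 ≔ lit 2 ⨟ 9 ≔ add 9 4 ⨟ 9 ≔ add 9 9 ⨟ 9 ≔ sub 1 9 ⨟ ifnz 9 enumerate skip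

halves-≤ : ∀ n → ⌊ n /2⌋ + ⌊ n /2⌋ ≤ n
halves-≤ n = ≤-trans (+-monoʳ-≤ ⌊ n /2⌋ (⌊n/2⌋≤⌈n/2⌉ n)) (≤-reflexive (⌊n/2⌋+⌈n/2⌉≡n n))

¬nonZero⇒≡0 : ∀ {m} → ¬ NonZero m → m ≡ 0
¬nonZero⇒≡0 {zero}  _   = refl
¬nonZero⇒≡0 {suc _} ¬nz = ⊥-elim (¬nz _)

gap-zero : ∀ {m n} → (m ∸ n) + (n ∸ m) ≡ 0 → n ≡ m
gap-zero {m} {n} eq = ≤-antisym (m∸n≡0⇒m≤n (m+n≡0⇒n≡0 (m ∸ n) eq)) (m∸n≡0⇒m≤n (m+n≡0⇒m≡0 (m ∸ n) eq))

-- The encoding of an instance is r ∷ #simplices K ∷ records (allFin _), with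
-- one record for each simplex.
module Encoding {v : ℕ} (K : Complex v) where

  -- The number of simplices.
  n₀ : ℕ
  n₀ = #simplices K

  recordWords : Fin n₀ → List ℕ
  recordWords i = dim (simplexAt K i) ∷ (length (facets K i) ∷ facets K i) ++ (length (cofacets K i) ∷ cofacets K i)

  records : List (Fin n₀) → List ℕ
  records = concatMap recordWords

  -- The length of the whole input, which starts with r and the number of simplices.
  inputEnd : ℕ
  inputEnd = 2 + length (records (allFin n₀))

  length≤records : ∀ is → length is ≤ length (records is)
  length≤records []       = z≤n
  length≤records (i ∷ is) = s≤s (≤-trans (length≤records is) (≤-trans (m≤n+m _ _) (≤-reflexive (sym (length-++ incidences)))))
    where
    incidences : List ℕ
    incidences = (length (facets K i) ∷ facets K i) ++ (length (cofacets K i) ∷ cofacets K i)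

-- Loops over the input, for an arbitrary word bound W.
module Machine {v : ℕ} (K : Complex v) (r : ℕ) (W : ℕ) where

  open Coboundary K r
  open Encoding K

  length-cofacets : ∀ i → length (cofacets K i) ≡ length (cofacetIndices i)
  length-cofacets i = length-map toℕ (cofacetIndices i)

  -- The record has dimension d, facets fs and cofacets cs, and is followed by the
  -- records rest.
  nextRecord-run : ∀ {d fs cs rest h a l p c n q x7 x8 x9 tl Q} →
    let ws = d ∷ ((length fs ∷ fs) ++ (length cs ∷ cs)) ++ rest in
    Segment h p ws → p + length ws ≤ W → d + r ≤ W →
    (∀ {p′ x9} → p′ + length cs + length rest ≡ p + length ws →
      Segment h p′ cs → Segment h (p′ + length cs) rest →
      Q (a ∷ l ∷ p′ ∷ c ∷ r ∷ n ∷ q ∷ ((r ∸ d) + (d ∸ r)) ∷ length cs ∷ x9 ∷ 1 ∷ tl) h) →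
    Run W nextRecord (a ∷ l ∷ p ∷ c ∷ r ∷ n ∷ q ∷ x7 ∷ x8 ∷ x9 ∷ 1 ∷ tl) h Q 10
  nextRecord-run {d} {fs} {cs} {rest} {h} {p = p} (hd , hf , s) end≤ d+r≤ q
    with s₁ , s₂ ← segment-++⁻ (2 + p) (fs ++ length cs ∷ cs) s
    with _ , (hc , s₃) ← segment-++⁻ (2 + p) fs s₁ =
    assign⨟ hd (≤-trans (m≤m+n d r) d+r≤) (assign⨟ (+-comm p 1) (below (s≤s (≤-trans (m≤n+m p 2) (m≤m+n (2 + p) (length fs)))))
    (assign⨟ hf (below (≤-trans (m≤n+m (length fs) (2 + p)) (n≤1+n _)))
    (assign⨟ (+-comm (suc p) 1) (below (≤-trans (m≤m+n (2 + p) (length fs)) (n≤1+n _)))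
    (assign⨟ refl (below (n≤1+n _))
    (assign⨟ hc (≤-trans (≤-trans (m≤n+m (length cs) (suc (2 + p + length fs))) (m≤m+n _ (length rest))) end′)
    (assign⨟ (+-comm (2 + p + length fs) 1) (below ≤-refl)
    (assign⨟ refl (≤-trans (m∸n≤m d r) (≤-trans (m≤m+n d r) d+r≤))
    (assign⨟ refl (≤-trans (m∸n≤m r d) (≤-trans (m≤n+m r d) d+r≤))
    (assign refl (≤-trans (+-mono-≤ (m∸n≤m r d) (m∸n≤m d r)) (≤-trans (≤-reflexive (+-comm r d)) d+r≤))
      (q end s₃ (subst (λ a → Segment h a rest) after s₂)))))))))))
    where
    regroup : ∀ p f c r → suc (suc (suc p) + f) + c + r ≡ p + suc (suc ((f + suc c) + r))
    regroup = solve-∀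
    regroup′ : ∀ p f c → suc (suc p) + (f + suc c) ≡ suc (suc (suc p) + f) + c
    regroup′ = solve-∀
    end : suc (2 + p + length fs) + length cs + length rest
          ≡ p + suc (suc (length ((fs ++ length cs ∷ cs) ++ rest)))
    end = trans (regroup p (length fs) (length cs) (length rest)) (cong (λ m → p + suc (suc m))
      (sym (trans (length-++ (fs ++ length cs ∷ cs)) (cong (_+ length rest) (length-++ fs)))))
    after : 2 + p + length (fs ++ length cs ∷ cs) ≡ suc (2 + p + length fs) + length cs
    after = trans (cong (2 + p +_) (length-++ fs)) (regroup′ p (length fs) (length cs))
    end′ : suc (2 + p + length fs) + length cs + length rest ≤ W
    end′ = ≤-trans (≤-reflexive end) end≤
    below : ∀ {m} → m ≤ suc (2 + p + length fs) → m ≤ W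
    below m≤ = ≤-trans m≤ (≤-trans (≤-trans (m≤m+n _ (length cs)) (m≤m+n _ (length rest))) end′)

  ifRow-run : ∀ i {P v h Q T} → nth v 7 ≡ (r ∸ dim σ[ i ]) + (dim σ[ i ] ∸ r) → nth v 8 ≡ length (cofacets K i) →
    (¬ IsRow i → Q v h) → (IsRow i → Run W P v h Q T) → Run W (ifRow P) v h Q (3 + T)
  ifRow-run i {v = v} {T = T} v7 v8 notRow isRow with dim σ[ i ] ≟ r | nonZero? (length (cofacetIndices i))
  ... | no  d≢r | _ = weaken (s≤s (s≤s z≤n)) (then! (subst NonZero (sym v7) gap) (skip! (notRow (d≢r ∘ proj₁))))
    where
    gap : NonZero ((r ∸ dim σ[ i ]) + (dim σ[ i ] ∸ r))
    gap = ≢-nonZero (d≢r ∘ gap-zero {r})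
  ... | yes d≡r | no ¬nz = weaken (s≤s (s≤s (s≤s z≤n)))
      (else! gap (else! (trans v8 (trans (length-cofacets i) (¬nonZero⇒≡0 ¬nz))) (skip! (notRow (¬nz ∘ proj₂)))))
    where
    gap : nth v 7 ≡ 0
    gap = trans v7 (trans (cong₂ _+_ (m≤n⇒m∸n≡0 (≤-reflexive (sym d≡r))) (m≤n⇒m∸n≡0 (≤-reflexive d≡r))) refl)
  ... | yes d≡r | yes nz = weaken (n≤1+n _)
      (else! gap (then! (subst NonZero (sym (trans v8 (length-cofacets i))) nz) (isRow (d≡r , nz))))
    where
    gap : nth v 7 ≡ 0
    gap = trans v7 (trans (cong₂ _+_ (m≤n⇒m∸n≡0 (≤-reflexive (sym d≡r))) (m≤n⇒m∸n≡0 (≤-reflexive d≡r))) refl)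

  -- Contents of registers 0, 1, 6 and those from 11 on, and of the heap, as
  -- they vary with the list of simplices not yet visited.
  Invariant : Set₁
  Invariant = List Index → (a l q : ℕ) → List ℕ → (ℕ → ℕ) → Set

  -- The loop over all records, for a program P that runs in TP steps on a row.
  -- P may not write below B, where the input is stored, and it has to preserve
  -- the invariant while the simplex i is removed from the list.
  module VisitAll (dims : ∀ i → dim σ[ i ] + r ≤ W) (B : ℕ) (B≤W : B ≤ W) (P : Program) (TP : ℕ) (Inv : Invariant)
    (passed : ∀ {i js a l q tl h} → ¬ IsRow i → Inv (i ∷ js) a l q tl h → Inv js a l q tl h)
    (body : ∀ {i js a l p c n q x7 x9 tl h Q} → IsRow i → Inv (i ∷ js) a l q tl h →
      Segment h p (cofacets K i) → p + length (cofacets K i) ≤ B →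
      (∀ {a′ l′ p′ q′ x7′ x8′ x9′ tl′ h′} → p′ + x8′ ≡ p + length (cofacets K i) → AgreeBelow B h h′ →
        Inv js a′ l′ q′ tl′ h′ → Q (a′ ∷ l′ ∷ p′ ∷ c ∷ r ∷ n ∷ q′ ∷ x7′ ∷ x8′ ∷ x9′ ∷ 1 ∷ tl′) h′) →
      Run W P (a ∷ l ∷ p ∷ c ∷ r ∷ n ∷ q ∷ x7 ∷ length (cofacets K i) ∷ x9 ∷ 1 ∷ tl) h Q TP) where

    -- Sixteen steps for each record: one for the loop test, ten for nextRecord, up to
    -- three for the tests in ifRow, and two for the final assignments.
    time : List Index → ℕ
    time js = 1 + length js * 16 + length (filter isRow? js) * TP

    visitAll : ∀ js {a l p n q x7 x8 x9 tl h Q} → Inv js a l q tl h →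
      Segment h p (records js) → p + length (records js) ≤ B → length js ≤ W →
      (∀ {a′ l′ q′ x7′ x8′ x9′ tl′ h′} → AgreeBelow B h h′ → Inv [] a′ l′ q′ tl′ h′ →
        Q (a′ ∷ l′ ∷ p + length (records js) ∷ 0 ∷ r ∷ n ∷ q′ ∷ x7′ ∷ x8′ ∷ x9′ ∷ 1 ∷ tl′) h′) →
      Run W (while 3 (visit P)) (a ∷ l ∷ p ∷ length js ∷ r ∷ n ∷ q ∷ x7 ∷ x8 ∷ x9 ∷ 1 ∷ tl) h Q (time js)
    visitAll [] {a} {l} {p} {n} {q} {x7} {x8} {x9} {tl} {h} {Q} inv s end≤ _ k = exit! refl
      (subst (λ p → Q (a ∷ l ∷ p ∷ 0 ∷ r ∷ n ∷ q ∷ x7 ∷ x8 ∷ x9 ∷ 1 ∷ tl) h) (+-identityʳ p) (k (λ _ → refl) inv))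
    visitAll (i ∷ js) {a} {l} {p} {n} {q} {tl = tl} {h = h} {Q} inv s end≤ len≤ k =
      weaken (≤-reflexive (time-cons (isRow? i))) (loop! _ (seq
        (nextRecord-run {d = dim σ[ i ]} {facets K i} {cofacets K i} {records js} s (≤-trans end≤ B≤W) (dims i)
          λ end s₁ s₂ → seq (branch (isRow? i) end s₁ s₂))))
      where
      branchTime : Dec (IsRow i) → ℕ
      branchTime (yes _) = TP
      branchTime (no  _) = 0

      Continue : Assertion
      Continue v₁ h₁ = Run W (2 ≔ add 2 8 ⨟ 3 ≔ sub 3 10) v₁ h₁ (λ v₂ h₂ → Run W (while 3 (visit P)) v₂ h₂ Q (time js)) 2

      -- The last two assignments of a pass, followed by the rest of the loop.
      finish : ∀ {a l p₁ q x7 x8 x9 tl h₁} → p₁ + x8 + length (records js) ≡ p + length (records (i ∷ js)) →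
        AgreeBelow B h h₁ → Segment h₁ (p₁ + x8) (records js) → Inv js a l q tl h₁ →
        Continue (a ∷ l ∷ p₁ ∷ suc (length js) ∷ r ∷ n ∷ q ∷ x7 ∷ x8 ∷ x9 ∷ 1 ∷ tl) h₁
      finish {p₁ = p₁} {x8 = x8} end agree s inv =
        assign⨟ refl (≤-trans (m≤m+n _ _) (≤-trans end≤₁ B≤W))
        (assign refl (≤-trans (n≤1+n _) len≤)
          (visitAll js inv s end≤₁ (≤-trans (n≤1+n _) len≤) λ {a′} {l′} {q′} {x7′} {x8′} {x9′} {tl′} {h′} agree′ inv′ →
            subst (λ e → Q (a′ ∷ l′ ∷ e ∷ 0 ∷ r ∷ n ∷ q′ ∷ x7′ ∷ x8′ ∷ x9′ ∷ 1 ∷ tl′) h′) (sym end)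
              (k (λ a< → trans (agree′ a<) (agree a<)) inv′)))
        where
        end≤₁ : p₁ + x8 + length (records js) ≤ B
        end≤₁ = ≤-trans (≤-reflexive end) end≤

      branch : ∀ (row? : Dec (IsRow i)) {p₁ x9} →
        p₁ + length (cofacets K i) + length (records js) ≡ p + length (records (i ∷ js)) →
        Segment h p₁ (cofacets K i) → Segment h (p₁ + length (cofacets K i)) (records js) →
        Run W (ifRow P) (a ∷ l ∷ p₁ ∷ suc (length js) ∷ r ∷ n ∷ q ∷ ((r ∸ dim σ[ i ]) + (dim σ[ i ] ∸ r)) ∷
                         length (cofacets K i) ∷ x9 ∷ 1 ∷ tl) h Continue (3 + branchTime row?)
      branch (no ¬row) end s₁ s₂ =
        ifRow-run i refl refl (λ _ → finish end (λ _ → refl) s₂ (passed ¬row inv)) (λ row → ⊥-elim (¬row row))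
      branch (yes row) {p₁} end s₁ s₂ =
        ifRow-run i refl refl (λ ¬row → ⊥-elim (¬row row)) λ _ →
          body row inv s₁ (≤-trans (m≤m+n _ _) bound) λ {_} {_} {p′} {_} {_} {x8′} {_} {_} {h′} p′+x8′ agree inv′ →
            finish (trans (cong (_+ length (records js)) p′+x8′) end) agree
              (subst (λ e → Segment h′ e (records js)) (sym p′+x8′) (segment-frame (records js) agree bound s₂)) inv′
        where
        bound : p₁ + length (cofacets K i) + length (records js) ≤ B
        bound = ≤-trans (≤-reflexive end) end≤

      time-cons : (row? : Dec (IsRow i)) → suc (10 + (3 + branchTime row? + 2) + time js) ≡ time (i ∷ js)
      time-cons (yes row) = trans (regroup TP (length js) (length (filter isRow? js) * TP))
        (cong (λ is → 1 + (16 + length js * 16) + length is * TP) (sym (filter-accept isRow? row)))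
        where
        regroup : ∀ t m u → suc (10 + (3 + t + 2) + (1 + m * 16 + u)) ≡ 1 + (16 + m * 16) + (t + u)
        regroup = solve-∀
      time-cons (no ¬row) = trans (regroup (length js) (length (filter isRow? js) * TP))
        (cong (λ is → 1 + (16 + length js * 16) + length is * TP) (sym (filter-reject isRow? ¬row)))
        where
        regroup : ∀ m u → suc (10 + (3 + 0 + 2) + (1 + m * 16 + u)) ≡ 1 + (16 + m * 16) + u
        regroup = solve-∀

bit≤1 : ∀ b → bit b ≤ 1
bit≤1 true  = ≤-refl
bit≤1 false = z≤n

bit-not : ∀ b → 1 ∸ bit b ≡ bit (not b)
bit-not true  = refl
bit-not false = refl

module Search {v : ℕ} (K : Complex v) (r : ℕ) (W : ℕ)
  (dims : ∀ i → dim (simplexAt K i) + r ≤ W) (n<W : #simplices K < W) where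

  open Coboundary K r
  open Encoding K
  open Machine K r W

  1≤W : 1 ≤ W
  1≤W = ≤-trans (s≤s z≤n) n<W

  -- Toggling parities

  -- The array of n₀ bits from address F on holds the values of b.
  Cells : ℕ → (ℕ → ℕ) → (Index → Bool) → Set
  Cells F h b = ∀ j → h (F + toℕ j) ≡ bit (b j)

  -- The heap from B on is unused.
  ZeroFrom : ℕ → (ℕ → ℕ) → Set
  ZeroFrom B h = ∀ {a} → B ≤ a → h a ≡ 0

  toggle-run : ∀ {F} cs {a l p c n q x7 x9 x y t b h Q} → F + n₀ ≤ W →
    Segment h p (map toℕ cs) → p + length (map toℕ cs) ≤ F → Cells F h b → ZeroFrom (F + n₀) h →
    (∀ {x9′ t′ h′} → AgreeBelow F h h′ → Cells F h′ (λ j → b j xor ⨁ cs (λ k → does (k Fin.≟ j))) → ZeroFrom (F + n₀) h′ →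
      Q (a ∷ l ∷ p + length (map toℕ cs) ∷ c ∷ r ∷ n ∷ q ∷ x7 ∷ 0 ∷ x9′ ∷ 1 ∷ F ∷ x ∷ y ∷ t′ ∷ []) h′) →
    Run W (while 8 toggle) (a ∷ l ∷ p ∷ c ∷ r ∷ n ∷ q ∷ x7 ∷ length (map toℕ cs) ∷ x9 ∷ 1 ∷ F ∷ x ∷ y ∷ t ∷ []) h Q (1 + length (map toℕ cs) * 8)
  toggle-run {F} [] {a} {l} {p} {c} {n} {q} {x7} {x9} {x} {y} {t} {b} {h} {Q} F≤ s p≤ cells zeros k = exit! refl
    (subst (λ p → Q (a ∷ l ∷ p ∷ c ∷ r ∷ n ∷ q ∷ x7 ∷ 0 ∷ x9 ∷ 1 ∷ F ∷ x ∷ y ∷ t ∷ []) h) (+-identityʳ p)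
      (k (λ _ → refl) (λ j → trans (cells j) (cong bit (sym (xor-identityʳ (b j))))) zeros))
  toggle-run {F} (i ∷ cs) {a} {l} {p} {c} {n} {q} {x7} {x9} {x} {y} {t} {b} {h} {Q} F≤ (hp , s) p≤ cells zeros k =
    loop! _
      (assign⨟ hp (≤-trans (<⇒≤ (Fin.toℕ<n i)) n≤W)
      (assign⨟ refl (≤-trans (+-monoʳ-≤ F (<⇒≤ (Fin.toℕ<n i))) F≤)
      (assign⨟ (cells i) (≤-trans (bit≤1 (b i)) 1≤W)
      (assign⨟ (bit-not (b i)) (≤-trans (bit≤1 (not (b i))) 1≤W)
      (seq (store!
      (assign⨟ (+-comm p 1) (≤-trans sp≤ F≤W)
      (assign {c = length (map toℕ cs)} refl (≤-trans (n≤1+n _) (≤-trans (m≤n+m (suc (length (map toℕ cs))) p) (≤-trans p≤ F≤W)))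
        (toggle-run cs F≤ (segment-frame (map toℕ cs) below p≤′ s)
          p≤′ cells₁ zeros₁
          λ {x9′} {t′} {h′} agree cells′ zeros′ →
            subst (λ e → Q (a ∷ l ∷ e ∷ c ∷ r ∷ n ∷ q ∷ x7 ∷ 0 ∷ x9′ ∷ 1 ∷ F ∷ x ∷ y ∷ t′ ∷ []) h′) (+-suc p (length (map toℕ cs)))
              (k (λ a< → trans (agree a<) (below a<))
                 (λ j → trans (cells′ j) (cong bit (xor-assoc (b j) (does (i Fin.≟ j)) _))) zeros′))))))))))
    where
    n≤W : n₀ ≤ W
    n≤W = <⇒≤ n<W
    F≤W : F ≤ W
    F≤W = ≤-trans (m≤m+n F n₀) F≤
    p≤′ : suc p + length (map toℕ cs) ≤ F
    p≤′ = subst (_≤ F) (+-suc p (length (map toℕ cs))) p≤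
    sp≤ : suc p ≤ F
    sp≤ = ≤-trans (m≤m+n (suc p) (length (map toℕ cs))) p≤′
    h₁ : ℕ → ℕ
    h₁ = h [ F + toℕ i ↦ bit (not (b i)) ]
    below : AgreeBelow F h h₁
    below {a} a< = update-other h _ (<⇒≢ (≤-trans a< (m≤m+n F (toℕ i))))
    cells₁ : Cells F h₁ (λ j → b j xor does (i Fin.≟ j))
    cells₁ j with i Fin.≟ j
    ... | yes refl = trans (update-same h (F + toℕ i) _) (cong bit (xor-comm true (b i)))
    ... | no  i≢j  = trans (update-other h _ (i≢j ∘ sym ∘ Fin.toℕ-injective ∘ +-cancelˡ-≡ F _ _))
                           (trans (cells j) (cong bit (sym (xor-identityʳ (b j)))))
    zeros₁ : ZeroFrom (F + n₀) h₁
    zeros₁ a≥ = trans (update-other h _ (<⇒≢ (≤-trans (+-monoʳ-< F (Fin.toℕ<n i)) a≥) ∘ sym)) (zeros a≥)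

  -- Adding all cofacets of i changes the parity of exactly the cofacets of i.
  cofacet-parity : ∀ i j → ⨁ (cofacetIndices i) (λ k → does (k Fin.≟ j)) ≡ ∂-entry σ[ i ] σ[ j ]
  cofacet-parity i j = trans (⨁-filter (λ j → σ[ i ] ⋖? σ[ j ]) indices _)
    (trans (⨁-cong indices λ {k} _ → ∧-comm (∂-entry σ[ i ] σ[ k ]) _)
      (⨁-indicator Fin._≟_ (Unique.allFin⁺ _) (∈-allFin j) (λ k → ∂-entry σ[ i ] σ[ k ])))

  -- The parities of the rows visited so far, chosen by the mask x, are in the
  -- array at F; y holds the remaining digits of x.
  record ToggleInv (F x a₀ l₀ : ℕ) (js : List Index) (a l q : ℕ) (tl : List ℕ) (h : ℕ → ℕ) : Set where
    constructor toggleInv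
    field
      {y t} : ℕ
      {b}   : Index → Bool
      a≡    : a ≡ a₀
      l≡    : l ≡ l₀
      tl≡   : tl ≡ F ∷ x ∷ y ∷ t ∷ []
      y≤W   : y ≤ W
      cells : Cells F h b
      total : ∀ j → b j xor δ (chosen y (filter isRow? js)) σ[ j ] ≡ δ (chosen x rows) σ[ j ]
      zeros : ZeroFrom (F + n₀) h

  toggle-passed : ∀ {F x a₀ l₀ i js a l q tl h} → ¬ IsRow i →
    ToggleInv F x a₀ l₀ (i ∷ js) a l q tl h → ToggleInv F x a₀ l₀ js a l q tl h
  toggle-passed ¬row (toggleInv {y} {b = b} a≡ l≡ tl≡ y≤ cells total zeros) = toggleInv a≡ l≡ tl≡ y≤ cells
    (λ j → trans (cong (λ is → b j xor δ (chosen y is) σ[ j ]) (sym (filter-reject isRow? ¬row))) (total j)) zeros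

  -- The running time is four assignments, one test, one step to leave the loop or to
  -- skip it, and eight steps for each of at most n₀ cofacets.
  toggle-body : ∀ {F x a₀ l₀ i js a l p c n q x7 x9 tl h Q} → F + n₀ ≤ W → IsRow i →
    ToggleInv F x a₀ l₀ (i ∷ js) a l q tl h → Segment h p (cofacets K i) → p + length (cofacets K i) ≤ F →
    (∀ {a′ l′ p′ q′ x7′ x8′ x9′ tl′ h′} → p′ + x8′ ≡ p + length (cofacets K i) → AgreeBelow F h h′ →
      ToggleInv F x a₀ l₀ js a′ l′ q′ tl′ h′ → Q (a′ ∷ l′ ∷ p′ ∷ c ∷ r ∷ n ∷ q′ ∷ x7′ ∷ x8′ ∷ x9′ ∷ 1 ∷ tl′) h′) →
    Run W toggleChosen (a ∷ l ∷ p ∷ c ∷ r ∷ n ∷ q ∷ x7 ∷ length (cofacets K i) ∷ x9 ∷ 1 ∷ tl) h Q (6 + n₀ * 8)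
  toggle-body {F} {x} {a} {l} {i} {js} {p = p} {c} {n} {q} {x7} {h = h} {Q} F≤ row (toggleInv {y} {t} {b} refl refl refl y≤ cells total zeros) s p≤ k =
    assign⨟ {c = ⌊ y /2⌋} refl (≤-trans (⌊n/2⌋≤n y) y≤)
    (assign⨟ refl (≤-trans (halves-≤ y) y≤)
    (assign⨟ {c = lowBit y} refl (≤-trans (m∸n≤m y (⌊ y /2⌋ + ⌊ y /2⌋)) y≤)
    (assign⨟ {c = ⌊ y /2⌋} refl (≤-trans (⌊n/2⌋≤n y) y≤) test)))
    where
    total′ : ∀ j → b j xor δ (chosen y (i ∷ filter isRow? js)) σ[ j ] ≡ δ (chosen x rows) σ[ j ]
    total′ j = trans (cong (λ is → b j xor δ (chosen y is) σ[ j ]) (sym (filter-accept isRow? row))) (total j)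
    test : Run W (ifnz 14 (while 8 toggle) skip)
             (a ∷ l ∷ p ∷ c ∷ r ∷ n ∷ q ∷ x7 ∷ length (cofacets K i) ∷ ⌊ y /2⌋ ∷ 1 ∷ F ∷ x ∷ ⌊ y /2⌋ ∷ lowBit y ∷ []) h Q (2 + n₀ * 8)
    test with lowBit y in low
    ... | zero = weaken (s≤s (s≤s z≤n)) (else! refl (skip! (k refl (λ _ → refl)
          (toggleInv refl refl refl (≤-trans (⌊n/2⌋≤n y) y≤) cells
            (λ j → trans (cong (λ is → b j xor δ is σ[ j ]) (sym (chosen-even y i _ low))) (total′ j)) zeros))))
    ... | suc _ = weaken (s≤s (s≤s (*-monoˡ-≤ 8 len≤))) (then! _
          (toggle-run (cofacetIndices i) F≤ s p≤ cells zeros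
            λ agree cells′ zeros′ → k (+-identityʳ _) agree
              (toggleInv refl refl refl (≤-trans (⌊n/2⌋≤n y) y≤) cells′ total″ zeros′)))
      where
      len≤ : length (cofacets K i) ≤ n₀
      len≤ = ≤-trans (≤-reflexive (length-cofacets i))
        (≤-trans (length-filter (λ j → σ[ i ] ⋖? σ[ j ]) indices) (≤-reflexive (length-tabulate (λ i → i))))
      total″ : ∀ j → (b j xor ⨁ (cofacetIndices i) (λ k → does (k Fin.≟ j))) xor δ (chosen ⌊ y /2⌋ (filter isRow? js)) σ[ j ]
                   ≡ δ (chosen x rows) σ[ j ]
      total″ j = trans (cong (λ e → (b j xor e) xor _) (cofacet-parity i j))
        (trans (xor-assoc (b j) _ _)
          (trans (cong (λ is → b j xor δ is σ[ j ]) (sym (chosen-odd y i _ low))) (total′ j)))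

  -- Collecting the support

  -- The loop has reached the index j, with k indices g 0, g 1, ... to go, and writes
  -- to address w.
  collect-run : ∀ {F b w h} k (g : Fin k → Index) {j a l p n q x7 x9 x t Q} → (∀ i → toℕ (g i) ≡ j + toℕ i) →
    Cells F h b → F + n₀ ≤ w → w + k ≤ W → j + k ≤ n₀ →
    (∀ {j′ x9′ h′} → Segment h′ w (map toℕ (filter (λ i → b i Bool.≟ true) (tabulate g))) →
      AgreeBelow w h h′ → (∀ {a} → w + k ≤ a → h′ a ≡ h a) →
      Q (a ∷ l ∷ p ∷ 0 ∷ r ∷ n ∷ q ∷ x7 ∷ j′ ∷ x9′ ∷ 1 ∷ F ∷ x ∷
         w + length (filter (λ i → b i Bool.≟ true) (tabulate g)) ∷ t ∷ []) h′) →
    Run W (while 3 collect) (a ∷ l ∷ p ∷ k ∷ r ∷ n ∷ q ∷ x7 ∷ j ∷ x9 ∷ 1 ∷ F ∷ x ∷ w ∷ t ∷ []) h Q (1 + k * 8)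
  collect-run {F} {b} {w} {h} zero g {j} {a} {l} {p} {n} {q} {x7} {x9} {x} {t} {Q} gi cells w≥ w≤ j≤ k =
    exit! refl (subst (λ e → Q (a ∷ l ∷ p ∷ 0 ∷ r ∷ n ∷ q ∷ x7 ∷ j ∷ x9 ∷ 1 ∷ F ∷ x ∷ e ∷ t ∷ []) h) (+-identityʳ w)
      (k tt (λ _ → refl) (λ _ → refl)))
  collect-run {F} {b} {w} {h} (suc m) g {j} {a} {l} {p} {n} {q} {x7} {x9} {x} {t} {Q} gi cells w≥ w≤ j≤ k =
    loop! _
      (assign⨟ refl (≤-trans (+-monoʳ-≤ F (<⇒≤ j<n)) (≤-trans w≥ w≤W))
      (assign⨟ (trans (cong (λ e → h (F + e)) (sym g0)) (cells (g zero))) (≤-trans (bit≤1 _) 1≤W)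
      (seq (test (b (g zero)) refl))))
    where
    g0 : toℕ (g zero) ≡ j
    g0 = trans (gi zero) (+-identityʳ j)
    gs : ∀ i → toℕ (g (suc i)) ≡ suc j + toℕ i
    gs i = trans (gi (suc i)) (+-suc j (toℕ i))
    j≤′ : suc j + m ≤ n₀
    j≤′ = subst (_≤ n₀) (+-suc j m) j≤
    j<n : j < n₀
    j<n = ≤-trans (m≤m+n (suc j) m) j≤′
    w≤W : w ≤ W
    w≤W = ≤-trans (m≤m+n w (suc m)) w≤
    w≤′ : suc w + m ≤ W
    w≤′ = subst (_≤ W) (+-suc w m) w≤
    m≤W : m ≤ W
    m≤W = ≤-trans (m≤n+m m (suc w)) w≤′
    sj≤W : suc j ≤ W
    sj≤W = ≤-trans j<n (<⇒≤ n<W)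
    Continue : Assertion
    Continue v₁ h₁ = Run W (8 ≔ add 8 10 ⨟ 3 ≔ sub 3 10) v₁ h₁ (λ v₂ h₂ → Run W (while 3 collect) v₂ h₂ Q (1 + m * 8)) 2
    test : ∀ c → b (g zero) ≡ c → Run W (ifnz 9 (store 13 8 ⨟ 13 ≔ add 13 10) skip)
             (a ∷ l ∷ p ∷ suc m ∷ r ∷ n ∷ q ∷ x7 ∷ j ∷ bit c ∷ 1 ∷ F ∷ x ∷ w ∷ t ∷ []) h Continue 3
    test false bg = weaken (s≤s (s≤s z≤n)) (else! refl (skip!
          (assign⨟ (+-comm j 1) sj≤W (assign {c = m} refl m≤W
            (collect-run m (g ∘ suc) gs cells w≥ (≤-trans (n≤1+n _) w≤′) j≤′ λ {j′} {x9′} {h′} s agree above →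
              subst (λ e → Q (a ∷ l ∷ p ∷ 0 ∷ r ∷ n ∷ q ∷ x7 ∷ j′ ∷ x9′ ∷ 1 ∷ F ∷ x ∷ e ∷ t ∷ []) h′)
                (cong (λ is → w + length is) rejected)
                (k (subst (λ is → Segment h′ w (map toℕ is)) (sym rejected) s) agree
                   (λ a≥ → above (≤-trans (n≤1+n _) (≤-trans (≤-reflexive (sym (+-suc w m))) a≥)))))))))
      where
      rejected : filter (λ i → b i Bool.≟ true) (tabulate g) ≡ filter (λ i → b i Bool.≟ true) (tabulate (g ∘ suc))
      rejected = filter-reject (λ i → b i Bool.≟ true) (λ eq → case trans (sym bg) eq of λ ())
    test true bg = then! _ (seq (store! (assign (+-comm w 1) (≤-trans (m≤m+n (suc w) m) w≤′)
          (assign⨟ (+-comm j 1) sj≤W (assign {c = m} refl m≤W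
            (collect-run m (g ∘ suc) gs cells₁ (≤-trans w≥ (n≤1+n w)) w≤′ j≤′ λ {j′} {x9′} {h′} s agree above →
              subst (λ e → Q (a ∷ l ∷ p ∷ 0 ∷ r ∷ n ∷ q ∷ x7 ∷ j′ ∷ x9′ ∷ 1 ∷ F ∷ x ∷ e ∷ t ∷ []) h′)
                (trans (cong (λ is → w + length is) accepted) (+-suc w _))
                (k (subst (λ is → Segment h′ w (map toℕ is)) (sym accepted)
                     (trans (agree ≤-refl) (trans (update-same h w j) (sym g0)) , s))
                   (λ a< → trans (agree (≤-trans a< (n≤1+n w))) (update-other h j (<⇒≢ a<)))
                   (λ a≥ → trans (above (≤-trans (≤-reflexive (sym (+-suc w m))) a≥))
                                  (update-other h j (<⇒≢ (≤-trans (s≤s (m≤m+n w m)) (≤-trans (≤-reflexive (sym (+-suc w m))) a≥)) ∘ sym))))))))))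
      where
      accepted : filter (λ i → b i Bool.≟ true) (tabulate g) ≡ g zero ∷ filter (λ i → b i Bool.≟ true) (tabulate (g ∘ suc))
      accepted = filter-accept (λ i → b i Bool.≟ true) bg
      cells₁ : Cells F (h [ w ↦ j ]) b
      cells₁ i = trans (update-other h j (<⇒≢ (≤-trans (+-monoʳ-< F (Fin.toℕ<n i)) w≥))) (cells i)

  -- The search over all sets of rows

  -- A solution of the instance, as a list of indices.
  Solution : List Index → Set
  Solution is = IsNontrivializing K r (map σ[_] is)

  -- The indices of a solution of cardinality l are stored from address a on.
  Candidate : (ℕ → ℕ) → ℕ → ℕ → Set
  Candidate h a l = ∃[ is ] length is ≡ l × Segment h a (map toℕ is) × Solution is

  candidate-frame : ∀ {h h′ B a l} → AgreeBelow B h h′ → a + l ≤ B → Candidate h a l → Candidate h′ a l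
  candidate-frame {B = B} {a} agree a+l≤ (is , refl , s , sol) =
    is , refl , segment-frame (map toℕ is) agree (subst (λ m → a + m ≤ B) (sym (length-map toℕ is)) a+l≤) s , sol

  -- The weight of the coboundary of the set of rows numbered x.
  weight : ℕ → ℕ
  weight x = length (support (chosen x rows))

  length-indices : length indices ≡ n₀
  length-indices = length-tabulate (λ i → i)

  length-support : ∀ A → length (support A) ≤ n₀
  length-support A = ≤-trans (length-filter (λ j → δ A σ[ j ] Bool.≟ true) indices) (≤-reflexive length-indices)

  length-rows : length rows ≤ n₀
  length-rows = ≤-trans (length-filter isRow? indices) (≤-reflexive length-indices)

  -- The masks from x on have been tried, the best solution found so far is the
  -- candidate, and the heap from F on is unused.
  record Searched (x a l F : ℕ) (h : ℕ → ℕ) : Set where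
    constructor find-trueed
    field
      room      : F + x * (n₀ + n₀) ≤ W
      input<F   : inputEnd ≤ F
      input     : Segment h 2 (records indices)
      zeros     : ZeroFrom F h
      candidate : Candidate h a l
      a+l≤F     : a + l ≤ F
      l≤n       : l ≤ n₀
      minimal   : ∀ y → x ≤ y → y < 2 ^ length rows → NonZero (weight y) → l ≤ weight y

  -- The summands follow the parts of tryMask.
  tryTime : ℕ
  tryTime = 4 + ((1 + n₀ * 16 + length rows * (6 + n₀ * 8)) + (4 + ((1 + n₀ * 8) + (1 + (6 + 1)))))

  tryMask-run : ∀ {x a l F p c q x7 x8 x9 y t h Q} → suc x ≤ W → Searched (suc x) a l F h →
    (∀ {a′ l′ p′ c′ q′ x7′ x8′ x9′ F′ y′ t′ h′} → Searched x a′ l′ F′ h′ →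
      Q (a′ ∷ l′ ∷ p′ ∷ c′ ∷ r ∷ n₀ ∷ q′ ∷ x7′ ∷ x8′ ∷ x9′ ∷ 1 ∷ F′ ∷ x ∷ y′ ∷ t′ ∷ []) h′) →
    Run W tryMask (a ∷ l ∷ p ∷ c ∷ r ∷ n₀ ∷ q ∷ x7 ∷ x8 ∷ x9 ∷ 1 ∷ F ∷ suc x ∷ y ∷ t ∷ []) h Q tryTime
  tryMask-run {x} {a} {l} {F} {q = q} {x7} {x8} {x9} {t = t} {h} {Q} x<W (find-trueed room input<F input zeros candidate a+l≤F l≤n minimal) k =
    assign⨟ {c = x} refl x≤W
    (assign⨟ {c = x} refl x≤W
    (assign⨟ refl (≤-trans (≤-trans (s≤s (s≤s z≤n)) input<F) F≤W)
    (assign⨟ refl n≤W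
    (seq (subst (λ m → Run W (while 3 (visit toggleChosen)) (a ∷ l ∷ 2 ∷ m ∷ r ∷ n₀ ∷ q ∷ x7 ∷ x8 ∷ x9 ∷ 1 ∷ F ∷ x ∷ x ∷ t ∷ []) h Toggled (1 + m * 16 + length rows * (6 + n₀ * 8))) length-indices
      (visitAll indices start input input<F (≤-trans (≤-reflexive length-indices) n≤W) λ agree inv → afterToggle agree inv))))))
    where
    n≤W : n₀ ≤ W
    n≤W = <⇒≤ n<W
    x≤W : x ≤ W
    x≤W = ≤-trans (n≤1+n x) x<W
    L F′ : ℕ
    L = F + n₀
    F′ = L + n₀
    -- The masks that remain take 2 n₀ cells each.
    room′ : F′ + x * (n₀ + n₀) ≤ W
    room′ = ≤-trans (≤-reflexive (regroup F n₀ (x * (n₀ + n₀)))) room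
      where
      regroup : ∀ f m u → f + m + m + u ≡ f + (m + m + u)
      regroup = solve-∀
    F′≤W : F′ ≤ W
    F′≤W = ≤-trans (m≤m+n F′ _) room′
    L≤W : L ≤ W
    L≤W = ≤-trans (m≤m+n L n₀) F′≤W
    F≤W : F ≤ W
    F≤W = ≤-trans (m≤m+n F n₀) L≤W
    open VisitAll dims F F≤W toggleChosen (6 + n₀ * 8) (ToggleInv F x a l) toggle-passed (toggle-body L≤W)

    S : List Index
    S = support (chosen x rows)

    b : Index → Bool
    b j = δ (chosen x rows) σ[ j ]

    start : ∀ {q t} → ToggleInv F x a l indices a l q (F ∷ x ∷ x ∷ t ∷ []) h
    start = toggleInv {b = λ _ → false} refl refl refl x≤W
      (λ j → zeros (m≤m+n F (toℕ j))) (λ j → refl) (λ a≥ → zeros (≤-trans (m≤m+n F n₀) a≥))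

    Finished : Assertion
    Finished = λ v₁ h₁ → Run W (8 ≔ sub 13 14 ⨟ keepBetter ⨟ 11 ≔ add 14 5) v₁ h₁ Q (1 + (6 + 1))

    Toggled : Assertion
    Toggled v₁ h₁ = Run W (14 ≔ add 11 5 ⨟ 13 ≔ reg 14 ⨟ 8 ≔ lit 0 ⨟ 3 ≔ reg 5 ⨟ while 3 collect ⨟
      8 ≔ sub 13 14 ⨟ keepBetter ⨟ 11 ≔ add 14 5) v₁ h₁ Q (4 + ((1 + n₀ * 8) + (1 + (6 + 1))))

    -- The bound for the current mask x together with that for the previous ones.
    better : ∀ {l′} → l′ ≤ l → (NonZero (length S) → l′ ≤ length S) →
             ∀ y → x ≤ y → y < 2 ^ length rows → NonZero (weight y) → l′ ≤ weight y
    better l′≤l l′≤S y x≤y y< nz with m≤n⇒m<n∨m≡n x≤y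
    ... | inj₁ x<y  = ≤-trans l′≤l (minimal y x<y y< nz)
    ... | inj₂ refl = l′≤S nz

    afterCollect : ∀ {p q x7 j x9 h₂} → Segment h₂ L (map toℕ S) → AgreeBelow F h h₂ → ZeroFrom F′ h₂ →
      Finished (a ∷ l ∷ p ∷ 0 ∷ r ∷ n₀ ∷ q ∷ x7 ∷ j ∷ x9 ∷ 1 ∷ F ∷ x ∷ L + length S ∷ L ∷ []) h₂
    afterCollect {p} {q} {x7} {j} {x9} {h₂} stored agree zeros₂ =
      assign⨟ (m+n∸m≡n L (length S)) (≤-trans (length-support (chosen x rows)) n≤W) (seq keep)
      where
      F≤F′ : F ≤ F′
      F≤F′ = ≤-trans (m≤m+n F n₀) (m≤m+n L n₀)
      input₂ : Segment h₂ 2 (records indices)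
      input₂ = segment-frame (records indices) agree input<F input
      old : l ≤ length S ⊎ length S ≡ 0 → Searched x a l F′ h₂
      old l≤S = find-trueed room′ (≤-trans input<F F≤F′) input₂ zeros₂ (candidate-frame agree a+l≤F candidate)
        (≤-trans a+l≤F F≤F′) l≤n (better ≤-refl (case l≤S of λ where
          (inj₁ l≤) _  → l≤
          (inj₂ z)  nz → ⊥-elim (≢-nonZero⁻¹ (length S) {{nz}} z)))
      new : NonZero (length S) → length S ≤ l → Searched x L (length S) F′ h₂
      new nz S≤l = find-trueed room′ (≤-trans input<F F≤F′) input₂ zeros₂
        (S , refl , stored , support-nontrivializing (chosen x rows) (chosen-⊆ x rows) nz)
        (+-monoʳ-≤ L (length-support (chosen x rows))) (length-support (chosen x rows))
        (better S≤l (λ _ → ≤-refl))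
      end : ∀ {a′ l′ x9′} → Searched x a′ l′ F′ h₂ →
        Run W (11 ≔ add 14 5) (a′ ∷ l′ ∷ p ∷ 0 ∷ r ∷ n₀ ∷ q ∷ x7 ∷ length S ∷ x9′ ∷ 1 ∷ F ∷ x ∷ L + length S ∷ L ∷ []) h₂ Q 1
      end done = assign refl F′≤W (k done)
      keep : Run W keepBetter (a ∷ l ∷ p ∷ 0 ∷ r ∷ n₀ ∷ q ∷ x7 ∷ length S ∷ x9 ∷ 1 ∷ F ∷ x ∷ L + length S ∷ L ∷ []) h₂
               (λ v₃ h₃ → Run W (11 ≔ add 14 5) v₃ h₃ Q 1) 6
      keep with nonZero? (length S)
      ... | no  ¬nz = weaken (s≤s (s≤s z≤n)) (else! S≡0 (skip! (end (old (inj₂ S≡0)))))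
        where
        S≡0 : length S ≡ 0
        S≡0 = ¬nonZero⇒≡0 ¬nz
      ... | yes nz = weaken (n≤1+n 5) (then! nz (assign⨟ {c = l ∸ length S} refl (≤-trans (m∸n≤m l (length S)) (≤-trans l≤n n≤W)) (compare nz)))
        where
        compare : NonZero (length S) → Run W (ifnz 9 (1 ≔ reg 8 ⨟ 0 ≔ reg 14) skip)
          (a ∷ l ∷ p ∷ 0 ∷ r ∷ n₀ ∷ q ∷ x7 ∷ length S ∷ l ∸ length S ∷ 1 ∷ F ∷ x ∷ L + length S ∷ L ∷ []) h₂
          (λ v₃ h₃ → Run W (11 ≔ add 14 5) v₃ h₃ Q 1) 3
        compare nz with nonZero? (l ∸ length S)
        ... | yes gt = then! gt (assign⨟ refl (≤-trans (length-support (chosen x rows)) n≤W) (assign refl L≤W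
                (end (new nz (<⇒≤ (m∸n≢0⇒n<m (≢-nonZero⁻¹ _ {{gt}})))))))
        ... | no ¬gt = weaken (s≤s (s≤s z≤n)) (else! l∸S≡0 (skip! (end (old (inj₁ (m∸n≡0⇒m≤n l∸S≡0))))))
          where
          l∸S≡0 : l ∸ length S ≡ 0
          l∸S≡0 = ¬nonZero⇒≡0 ¬gt

    afterToggle : ∀ {a′ l′ q x7 x8 x9 tl h₁} → AgreeBelow F h h₁ → ToggleInv F x a l [] a′ l′ q tl h₁ →
      Toggled (a′ ∷ l′ ∷ inputEnd ∷ 0 ∷ r ∷ n₀ ∷ q ∷ x7 ∷ x8 ∷ x9 ∷ 1 ∷ tl) h₁
    afterToggle agree (toggleInv {b = b′} refl refl refl y≤ cells total zeros₁) =
      assign⨟ {c = L} refl L≤W (assign⨟ {c = L} refl L≤W (assign⨟ refl z≤n (assign⨟ {c = n₀} refl n≤W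
      (seq (collect-run {b = b} n₀ (λ i → i) (λ i → refl)
        (λ j → trans (cells j) (cong bit (trans (sym (xor-identityʳ (b′ j))) (total j))))
        ≤-refl F′≤W ≤-refl
        λ s agree′ above → afterCollect s
          (λ a< → trans (agree′ (≤-trans a< (m≤m+n F n₀))) (agree a<))
          (λ a≥ → trans (above a≥) (zeros₁ (≤-trans (m≤m+n L n₀) a≥))))))))

  -- All masks below x are tried.
  search-run : ∀ x {a l F p c q x7 x8 x9 y t h Q} → x ≤ W → Searched x a l F h →
    (∀ {a′ l′ v′ F′ h′} → Searched 0 a′ l′ F′ h′ → Q (a′ ∷ l′ ∷ v′) h′) →
    Run W (while 12 tryMask) (a ∷ l ∷ p ∷ c ∷ r ∷ n₀ ∷ q ∷ x7 ∷ x8 ∷ x9 ∷ 1 ∷ F ∷ x ∷ y ∷ t ∷ []) h Q (1 + x * (1 + tryTime))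
  search-run zero    x≤ s k = exit! refl (k s)
  search-run (suc x) x≤ s k = weaken (≤-reflexive (regroup tryTime (x * (1 + tryTime))))
    (loop! _ (tryMask-run x≤ s λ s′ → search-run x (≤-trans (n≤1+n x) x≤) s′ k))
    where
    regroup : ∀ t u → suc (t + (1 + u)) ≡ 1 + (1 + t + u)
    regroup = solve-∀

  double-run : ∀ q {a l p c n x7 x8 x9 F x y t h Q} → x * 2 ^ q ≤ W → q ≤ W →
    Q (a ∷ l ∷ p ∷ c ∷ r ∷ n ∷ 0 ∷ x7 ∷ x8 ∷ x9 ∷ 1 ∷ F ∷ x * 2 ^ q ∷ y ∷ t ∷ []) h →
    Run W (while 6 double) (a ∷ l ∷ p ∷ c ∷ r ∷ n ∷ q ∷ x7 ∷ x8 ∷ x9 ∷ 1 ∷ F ∷ x ∷ y ∷ t ∷ []) h Q (1 + q * 3)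
  double-run zero {a} {l} {p} {c} {n} {x7} {x8} {x9} {F} {x} {y} {t} {h} {Q} x≤ q≤ k = exit! refl
    (subst (λ e → Q (a ∷ l ∷ p ∷ c ∷ r ∷ n ∷ 0 ∷ x7 ∷ x8 ∷ x9 ∷ 1 ∷ F ∷ e ∷ y ∷ t ∷ []) h) (*-identityʳ x) k)
  double-run (suc q) {a} {l} {p} {c} {n} {x7} {x8} {x9} {F} {x} {y} {t} {h} {Q} x≤ q≤ k =
    loop! _ (assign⨟ refl (≤-trans (m≤m*n (x + x) (2 ^ q) {{m^n≢0 2 q}}) x≤′) (assign {c = q} refl (≤-trans (n≤1+n q) q≤)
      (double-run q x≤′ (≤-trans (n≤1+n q) q≤)
        (subst (λ e → Q (a ∷ l ∷ p ∷ c ∷ r ∷ n ∷ 0 ∷ x7 ∷ x8 ∷ x9 ∷ 1 ∷ F ∷ e ∷ y ∷ t ∷ []) h) (regroup x (2 ^ q)) k))))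
    where
    regroup : ∀ x u → x * (2 * u) ≡ (x + x) * u
    regroup = solve-∀
    x≤′ : (x + x) * 2 ^ q ≤ W
    x≤′ = subst (_≤ W) (regroup x (2 ^ q)) x≤

module Execution {v : ℕ} (K : Complex v) (r : ℕ) (W : ℕ)
  (dims : ∀ i → dim (simplexAt K i) + r ≤ W) (n<W : #simplices K < W)
  (h₀ : ℕ → ℕ) (h₀-zeros : ∀ {a} → Encoding.inputEnd K ≤ a → h₀ a ≡ 0)
  (h₀-input : Segment h₀ 2 (Encoding.records K (allFin (#simplices K))))
  (input≤W : Encoding.inputEnd K ≤ W) where

  open Coboundary K r
  open Encoding K
  open Machine K r W
  open Search K r W dims n<W

  n≤W : n₀ ≤ W
  n≤W = <⇒≤ n<W

  -- The smallest coboundary of a single row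

  -- The rows outside js have been visited: their number is q, and the shortest of
  -- their lists of cofacets has length l and address a.  As long as no row
  -- has been visited, l is suc n₀.
  record ScanInv (js : List Index) (a l q : ℕ) (tl : List ℕ) (h : ℕ → ℕ) : Set where
    constructor scanInv
    field
      heap≡ : h ≡ h₀
      tl≡   : tl ≡ []
      best  : (Candidate h₀ a l × a + l ≤ inputEnd × l ≤ n₀) ⊎ l ≡ suc n₀
      lower : ∀ {i} → i ∈ rows → i ∈ js ⊎ l ≤ length (cofacetIndices i)
      count : q + length (filter isRow? js) ≡ length rows

  scan-passed : ∀ {i js a l q tl h} → ¬ IsRow i → ScanInv (i ∷ js) a l q tl h → ScanInv js a l q tl h
  scan-passed {js = js} {l = l} {q = q} ¬row (scanInv h≡ tl≡ best lower count) = scanInv h≡ tl≡ best lower′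
    (trans (cong (λ is → q + length is) (sym (filter-reject isRow? ¬row))) count)
    where
    lower′ : ∀ {i} → i ∈ rows → i ∈ js ⊎ l ≤ length (cofacetIndices i)
    lower′ i∈ = [ (λ { (here refl) → ⊥-elim (¬row (∈-rows⁻ i∈)) ; (there i∈js) → inj₁ i∈js }) , inj₂ ]′ (lower i∈)

  cofacets≤n : ∀ i → length (cofacetIndices i) ≤ n₀
  cofacets≤n i = ≤-trans (length-filter (λ j → σ[ i ] ⋖? σ[ j ]) indices) (≤-reflexive length-indices)

  -- The cofacets of a single row form the support of its coboundary.
  cofacets-solution : ∀ {i} → IsRow i → Solution (cofacetIndices i)
  cofacets-solution {i} row@(_ , nz) = subst Solution (support-singleton i)
    (support-nontrivializing (i ∷ []) (λ { (here refl) → ∈-rows⁺ row })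
      (subst (NonZero ∘ length) (sym (support-singleton i)) nz))

  scan-body : ∀ {i js a l p c n q x7 x9 tl h Q} → IsRow i → ScanInv (i ∷ js) a l q tl h →
    Segment h p (cofacets K i) → p + length (cofacets K i) ≤ inputEnd →
    (∀ {a′ l′ p′ q′ x7′ x8′ x9′ tl′ h′} → p′ + x8′ ≡ p + length (cofacets K i) → AgreeBelow inputEnd h h′ →
      ScanInv js a′ l′ q′ tl′ h′ → Q (a′ ∷ l′ ∷ p′ ∷ c ∷ r ∷ n ∷ q′ ∷ x7′ ∷ x8′ ∷ x9′ ∷ 1 ∷ tl′) h′) →
    Run W recordBest (a ∷ l ∷ p ∷ c ∷ r ∷ n ∷ q ∷ x7 ∷ length (cofacets K i) ∷ x9 ∷ 1 ∷ tl) h Q 5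
  scan-body {i} {js} {a} {l} {p} {c} {n} {q} {x7} {x9} {h = h} {Q} row (scanInv refl refl best lower count) s p≤ k =
    assign⨟ (+-comm q 1) q<W (assign⨟ {c = l ∸ len} refl (≤-trans (m∸n≤m l len) l≤W) compare)
    where
    len = length (cofacets K i)
    len≡ : len ≡ length (cofacetIndices i)
    len≡ = length-cofacets i
    l≤W : l ≤ W
    l≤W = [ (λ (_ , _ , l≤) → ≤-trans l≤ n≤W) , (λ { refl → n<W }) ]′ best
    count′ : suc q + length (filter isRow? js) ≡ length rows
    count′ = trans (sym (+-suc q _)) (trans (cong (λ is → q + length is) (sym (filter-accept isRow? row))) count)
    q<W : suc q ≤ W
    q<W = ≤-trans (m≤m+n (suc q) _) (≤-trans (≤-reflexive count′) (≤-trans length-rows n≤W))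
    lowered : ∀ {l′} → l′ ≤ l → l′ ≤ length (cofacetIndices i) → ∀ {j} → j ∈ rows → j ∈ js ⊎ l′ ≤ length (cofacetIndices j)
    lowered l′≤l l′≤ j∈ =
      [ (λ { (here refl) → inj₂ l′≤ ; (there j∈js) → inj₁ j∈js }) , inj₂ ∘ ≤-trans l′≤l ]′ (lower j∈)
    compare : Run W (ifnz 9 (1 ≔ reg 8 ⨟ 0 ≔ reg 2) skip)
      (a ∷ l ∷ p ∷ c ∷ r ∷ n ∷ suc q ∷ x7 ∷ len ∷ l ∸ len ∷ 1 ∷ []) h₀ Q 3
    compare with nonZero? (l ∸ len)
    ... | no ¬gt = weaken (s≤s (s≤s z≤n)) (else! l∸len≡0 (skip! (k refl (λ _ → refl)
            (scanInv refl refl best (lowered ≤-refl (≤-trans (m∸n≡0⇒m≤n l∸len≡0) (≤-reflexive len≡))) count′))))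
      where
      l∸len≡0 : l ∸ len ≡ 0
      l∸len≡0 = ¬nonZero⇒≡0 ¬gt
    ... | yes gt = then! gt (assign⨟ refl (≤-trans (≤-reflexive len≡) (≤-trans (cofacets≤n i) n≤W))
            (assign refl (≤-trans (m≤m+n p len) (≤-trans p≤ input≤W)) (k refl (λ _ → refl)
              (scanInv refl refl (inj₁ ((cofacetIndices i , sym len≡ , s , cofacets-solution row) , p≤ , ≤-trans (≤-reflexive len≡) (cofacets≤n i)))
                (lowered (<⇒≤ (m∸n≢0⇒n<m (≢-nonZero⁻¹ _ {{gt}}))) (≤-reflexive len≡)) count′))))

  candidate-nonempty : ∀ {h a l} → Candidate h a l → 1 ≤ l
  candidate-nonempty (is , refl , _ , sol) = solution-nonempty is sol

  -- The whole algorithm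

  -- The two guarantees for a solution of cardinality l: a logarithmic size, or
  -- minimality among the nonzero coboundaries of sets of rows.
  LogSmall Minimum : ℕ → Set
  LogSmall l = l ≤ 2 * (2 + r)
  Minimum l = ∀ y → y < 2 ^ length rows → NonZero (weight y) → l ≤ weight y

  -- The output is a solution with one of the two guarantees.
  Outcome : Assertion
  Outcome v h = ∃[ a ] ∃[ l ] ∃[ w ] v ≡ a ∷ l ∷ w × Candidate h a l × (LogSmall l ⊎ Minimum l)

  -- The running time of enumerate.
  enumerateTime : ℕ
  enumerateTime = 3 + ((1 + length rows * 3) + (1 + 2 ^ length rows * (1 + tryTime)))

  enumerate-run : ∀ {a l x7 x8 x9} → inputEnd + 2 ^ length rows * (n₀ + n₀) ≤ W →
    Candidate h₀ a l → a + l ≤ inputEnd → l ≤ n₀ →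
    Run W enumerate (a ∷ l ∷ inputEnd ∷ 0 ∷ r ∷ n₀ ∷ length rows ∷ x7 ∷ x8 ∷ x9 ∷ 1 ∷ []) h₀ Outcome enumerateTime
  enumerate-run {a} {l} {x7} {x8} {x9} room candidate a+l≤ l≤n =
    assign⨟ refl z≤n (assign⨟ refl input≤W (assign⨟ refl (≤-trans (s≤s z≤n) n<W)
    (seq (double-run q (≤-trans (≤-reflexive (*-identityˡ _)) pow≤W) (≤-trans length-rows n≤W)
      (subst (λ x → Run W (while 12 tryMask) (a ∷ l ∷ inputEnd ∷ 0 ∷ r ∷ n₀ ∷ 0 ∷ x7 ∷ x8 ∷ x9 ∷ 1 ∷ inputEnd ∷ x ∷ 0 ∷ 0 ∷ []) h₀
                Outcome (1 + 2 ^ q * (1 + tryTime))) (sym (*-identityˡ (2 ^ q)))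
        (search-run (2 ^ q) pow≤W
          (find-trueed room ≤-refl h₀-input h₀-zeros candidate a+l≤ l≤n (λ y ≤y y< _ → ⊥-elim (<⇒≱ y< ≤y)))
          λ {a′} {l′} {v′} s → a′ , l′ , v′ , refl , Searched.candidate s ,
            inj₂ λ y → Searched.minimal s y z≤n))))))
    where
    q = length rows
    pow≤W : 2 ^ q ≤ W
    pow≤W = ≤-trans (m≤m*n (2 ^ q) (n₀ + n₀) {{>-nonZero n+n>0}}) (≤-trans (m≤n+m _ inputEnd) room)
      where
      n+n>0 : 0 < n₀ + n₀
      n+n>0 = ≤-trans (≤-trans (candidate-nonempty candidate) l≤n) (m≤m+n n₀ n₀)

  open VisitAll dims inputEnd input≤W recordBest 5 ScanInv scan-passed scan-body renaming (time to visitTime)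

  -- The bounds needed for the enumeration are demanded only if every row has more
  -- than 2 (r + 2) cofacets, since the enumeration is not entered otherwise.
  algorithm-run : ∀ {TE} → h₀ 0 ≡ r → h₀ 1 ≡ n₀ → ∃[ i ] i ∈ rows → 2 + r + (2 + r) ≤ W → 1 ≤ TE →
    ((∀ {i} → i ∈ rows → 2 * (2 + r) < length (cofacetIndices i)) →
      inputEnd + 2 ^ length rows * (n₀ + n₀) ≤ W × enumerateTime ≤ TE) →
    Run W algorithm [] h₀ Outcome (6 + (1 + n₀ * 16 + length rows * 5 + (4 + suc TE)))
  algorithm-run {TE} h0 h1 (i₀ , i₀∈) small 1≤TE few =
    assign⨟ refl 1≤W (assign⨟ h0 r≤W (assign⨟ h1 n≤W (assign⨟ refl (≤-trans (s≤s (s≤s z≤n)) small) (assign⨟ refl n≤W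
    (assign⨟ (+-comm n₀ 1) n<W
    (seq (subst (λ m → Run W (while 3 (visit recordBest)) (0 ∷ suc n₀ ∷ 2 ∷ m ∷ r ∷ n₀ ∷ 0 ∷ 0 ∷ 0 ∷ 0 ∷ 1 ∷ []) h₀ Scanned
                 (1 + m * 16 + length rows * 5)) length-indices
      (visitAll indices (scanInv refl refl (inj₂ refl) (λ {i} i∈ → inj₁ (∈-allFin i)) refl) h₀-input ≤-refl
        (≤-trans (≤-reflexive length-indices) n≤W) λ agree inv → afterScan inv))))))))
    where
    r≤W : r ≤ W
    r≤W = ≤-trans (m≤n+m r 2) (≤-trans (m≤m+n (2 + r) (2 + r)) small)
    Scanned : Assertion
    Scanned v h = Run W (9 ≔ lit 2 ⨟ 9 ≔ add 9 4 ⨟ 9 ≔ add 9 9 ⨟ 9 ≔ sub 1 9 ⨟ ifnz 9 enumerate skip) v h Outcome (4 + suc TE)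
    limit : ℕ
    limit = 2 + r + (2 + r)
    limit≡ : limit ≡ 2 * (2 + r)
    limit≡ = cong (2 + r +_) (sym (+-identityʳ (2 + r)))
    afterScan : ∀ {a l q x7 x8 x9 tl h} → ScanInv [] a l q tl h →
      Scanned (a ∷ l ∷ inputEnd ∷ 0 ∷ r ∷ n₀ ∷ q ∷ x7 ∷ x8 ∷ x9 ∷ 1 ∷ tl) h
    afterScan {a} {l} {q} {x7} {x8} {x9} (scanInv refl refl best lower count) with trans (sym (+-identityʳ q)) count | best
    ... | refl | inj₂ refl = ⊥-elim ([ (λ ()) , (λ n< → <⇒≱ n< (cofacets≤n i₀)) ]′ (lower i₀∈))
    ... | refl | inj₁ (candidate , a+l≤ , l≤n) =
      assign⨟ refl (≤-trans (s≤s (s≤s z≤n)) small) (assign⨟ refl (≤-trans (m≤m+n (2 + r) (2 + r)) small)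
      (assign⨟ {c = limit} refl small (assign⨟ {c = l ∸ limit} refl (≤-trans (m∸n≤m l limit) (≤-trans l≤n n≤W)) decide)))
      where
      lower′ : ∀ {i} → i ∈ rows → l ≤ length (cofacetIndices i)
      lower′ i∈ = [ (λ ()) , (λ l≤ → l≤) ]′ (lower i∈)
      decide : Run W (ifnz 9 enumerate skip)
        (a ∷ l ∷ inputEnd ∷ 0 ∷ r ∷ n₀ ∷ length rows ∷ x7 ∷ x8 ∷ l ∸ limit ∷ 1 ∷ []) h₀ Outcome (suc TE)
      decide with nonZero? (l ∸ limit)
      ... | no ¬gt = weaken (s≤s 1≤TE) (else! l∸≡0 (skip! (a , l , _ , refl , candidate ,
              inj₁ (≤-trans (m∸n≡0⇒m≤n l∸≡0) (≤-reflexive limit≡)))))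
        where
        l∸≡0 : l ∸ limit ≡ 0
        l∸≡0 = ¬nonZero⇒≡0 ¬gt
      ... | yes gt with room , fast ← few (λ i∈ → ≤-trans (s≤s (≤-reflexive (sym limit≡)))
                          (≤-trans (m∸n≢0⇒n<m (≢-nonZero⁻¹ _ {{gt}})) (lower′ i∈))) =
        then! gt (weaken fast (enumerate-run room candidate a+l≤ l≤n))

-- Time bounds

1+n≤2^n : ∀ n → suc n ≤ 2 ^ n
1+n≤2^n zero    = ≤-refl
1+n≤2^n (suc n) =
  ≤-trans (≤-trans (s≤s (m≤n+m (suc n) n)) (≤-reflexive (double≡ n))) (*-monoʳ-≤ 2 (1+n≤2^n n))
  where
  double≡ : ∀ n → suc (n + suc n) ≡ 2 * suc n
  double≡ = solve-∀

-- The running time of the enumeration for m simplices, q rows, Betti number b,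
-- p = 2 ^ q and P = 2 ^ β.
enumeration-cost : ∀ {m q p b P} → 1 ≤ m → q ≤ m → q ≤ b → p ≤ P →
  3 + ((1 + q * 3) + (1 + p * (1 + (4 + ((1 + m * 16 + q * (6 + m * 8)) + (4 + ((1 + m * 8) + (1 + (6 + 1)))))))))
  ≤ 5 + m * 3 + P * (b + 1) * m * 43
enumeration-cost {m} {q} {p} {b} {P} 1≤m q≤m q≤b p≤P = begin
  3 + ((1 + q * 3) + (1 + p * (1 + (4 + ((1 + m * 16 + q * (6 + m * 8)) + (4 + ((1 + m * 8) + (1 + (6 + 1)))))))))
    ≡⟨ collect≡ m q p ⟩
  5 + q * 3 + p * (19 + m * 24 + q * (6 + m * 8))
    ≤⟨ +-mono-≤ (+-monoʳ-≤ 5 (*-monoˡ-≤ 3 q≤m)) (*-mono-≤ p≤P (+-mono-≤ (+-monoˡ-≤ (m * 24) 19≤) (*-mono-≤ q≤b (+-monoˡ-≤ (m * 8) 6≤)))) ⟩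
  5 + m * 3 + P * (m * 19 + m * 24 + b * (m * 6 + m * 8))
    ≤⟨ +-monoʳ-≤ (5 + m * 3) (*-monoʳ-≤ P (≤-trans (m≤m+n _ (b * m * 29)) (≤-reflexive (total≡ m b)))) ⟩
  5 + m * 3 + P * ((b + 1) * m * 43)
    ≡⟨ cong (5 + m * 3 +_) (assoc≡ P (b + 1) m) ⟩
  5 + m * 3 + P * (b + 1) * m * 43 ∎
  where
  open ≤-Reasoning
  19≤ : 19 ≤ m * 19
  19≤ = *-monoˡ-≤ 19 1≤m
  6≤ : 6 ≤ m * 6
  6≤ = *-monoˡ-≤ 6 1≤m
  collect≡ : ∀ m q p → 3 + ((1 + q * 3) + (1 + p * (1 + (4 + ((1 + m * 16 + q * (6 + m * 8)) + (4 + ((1 + m * 8) + (1 + (6 + 1)))))))))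
    ≡ 5 + q * 3 + p * (19 + m * 24 + q * (6 + m * 8))
  collect≡ = solve-∀
  total≡ : ∀ m b → m * 19 + m * 24 + b * (m * 6 + m * 8) + b * m * 29 ≡ (b + 1) * m * 43
  total≡ = solve-∀
  assoc≡ : ∀ P c m → P * (c * m * 43) ≡ P * c * m * 43
  assoc≡ = solve-∀

-- The total running time, for the same parameters.  The constant 100 is not sharp.
algorithm-cost : ∀ {m q b P} → 1 ≤ m → q ≤ m → 1 ≤ P →
  6 + (1 + m * 16 + q * 5 + (4 + suc (5 + m * 3 + P * (b + 1) * m * 43))) ≤ 100 * (P * (b + 1) * m)
algorithm-cost {m} {q} {b} {P} 1≤m q≤m 1≤P = begin
  6 + (1 + m * 16 + q * 5 + (4 + suc (5 + m * 3 + X * 43)))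
    ≤⟨ +-monoʳ-≤ 6 (+-monoˡ-≤ (4 + suc (5 + m * 3 + X * 43)) (+-monoʳ-≤ (1 + m * 16) (*-monoˡ-≤ 5 q≤m))) ⟩
  6 + (1 + m * 16 + m * 5 + (4 + suc (5 + m * 3 + X * 43)))
    ≡⟨ collect≡ m X ⟩
  17 + m * 24 + X * 43
    ≤⟨ +-monoˡ-≤ (X * 43) (+-mono-≤ (*-monoˡ-≤ 17 (≤-trans 1≤m m≤X)) (*-monoˡ-≤ 24 m≤X)) ⟩
  X * 17 + X * 24 + X * 43
    ≤⟨ ≤-trans (m≤m+n _ (X * 16)) (≤-reflexive (total≡ X)) ⟩
  100 * X ∎
  where
  open ≤-Reasoning
  X : ℕ
  X = P * (b + 1) * m
  m≤X : m ≤ X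
  m≤X = ≤-trans (≤-reflexive (sym (*-identityˡ m))) (*-monoˡ-≤ m (*-mono-≤ 1≤P (m≤n+m 1 b)))
  collect≡ : ∀ m X → 6 + (1 + m * 16 + m * 5 + (4 + suc (5 + m * 3 + X * 43))) ≡ 17 + m * 24 + X * 43
  collect≡ = solve-∀
  total≡ : ∀ X → X * 17 + X * 24 + X * 43 + X * 16 ≡ 100 * X
  total≡ = solve-∀

-- The parameter function k ↦ 100 · 4ᵏ

-- Starts with 100 and multiplies by 4 as often as the input in register 2 says;
-- the result replaces the input at address 0.
power : Program
power = 1 ≔ lit 1 ⨟ 2 ≔ load 0 ⨟ 3 ≔ lit 100 ⨟ 4 ≔ lit 4 ⨟ while 2 (3 ≔ mul 3 4 ⨟ 2 ≔ sub 2 1) ⨟ store 0 3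

power-loop : ∀ {W h Q} k x → x * 4 ^ k ≤ W → k ≤ W → Q (0 ∷ 1 ∷ 0 ∷ x * 4 ^ k ∷ 4 ∷ []) h →
  Run W (while 2 (3 ≔ mul 3 4 ⨟ 2 ≔ sub 2 1)) (0 ∷ 1 ∷ k ∷ x ∷ 4 ∷ []) h Q (1 + k * 3)
power-loop {h = h} {Q} zero x x≤ k≤ q = exit! refl (subst (λ e → Q (0 ∷ 1 ∷ 0 ∷ e ∷ 4 ∷ []) h) (*-identityʳ x) q)
power-loop {W} {h} {Q} (suc k) x x≤ k≤ q =
  loop! _ (assign⨟ refl (≤-trans (m≤m*n (x * 4) (4 ^ k) {{m^n≢0 4 k}}) x≤′) (assign {c = k} refl (≤-trans (n≤1+n k) k≤)
    (power-loop k (x * 4) x≤′ (≤-trans (n≤1+n k) k≤)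
      (subst (λ e → Q (0 ∷ 1 ∷ 0 ∷ e ∷ 4 ∷ []) h) (sym (*-assoc x 4 (4 ^ k))) q))))
  where
  x≤′ : x * 4 * 4 ^ k ≤ W
  x≤′ = subst (_≤ W) (sym (*-assoc x 4 (4 ^ k))) x≤

-- The final state of power on input k.
PowerStored : ℕ → Assertion
PowerStored k v h = v ≡ 0 ∷ 1 ∷ 0 ∷ 100 * 4 ^ k ∷ 4 ∷ [] × h 0 ≡ 100 * 4 ^ k

power-run : ∀ k → Run (100 * 4 ^ k + k) power [] (nth (k ∷ [])) (PowerStored k) (4 + ((1 + k * 3) + 1))
power-run k =
  assign⨟ refl (≤-trans (s≤s z≤n) 100≤) (assign⨟ {c = k} refl k≤ (assign⨟ refl 100≤
  (assign⨟ refl (≤-trans (s≤s (s≤s (s≤s (s≤s z≤n)))) 100≤)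
  (seq (power-loop k 100 pow≤ k≤ (store! (refl , refl)))))))
  where
  k≤ : k ≤ 100 * 4 ^ k + k
  k≤ = m≤n+m k (100 * 4 ^ k)
  pow≤ : 100 * 4 ^ k ≤ 100 * 4 ^ k + k
  pow≤ = m≤m+n _ k
  100≤ : 100 ≤ 100 * 4 ^ k + k
  100≤ = ≤-trans (m≤m*n 100 (4 ^ k) {{m^n≢0 4 k}}) pow≤

power-computable : Computable (λ k → 100 * 4 ^ k)
power-computable = power , λ k →
  let t , s , d , _ , ρ = Run.exec (power-run k) (represents (λ _ → refl) (λ _ → refl))
  in 100 * 4 ^ k + k , t , s , d , stored k ρ (Run.post (power-run k))
  where
  stored : ∀ k {s v h} → Represents s v h → PowerStored k v h → output s ≡ 100 * 4 ^ k ∷ []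
  stored k {s} (represents r≗ h≗) (refl , h0) =
    trans (cong₂ (λ a l → applyUpTo (λ i → heap s (a + i)) l) (r≗ 0) (r≗ 1)) (cong (_∷ []) (trans (h≗ 0) h0))

-- Running the algorithm on an instance

card>0⇒nonempty : ∀ {v} {τ : Subset v} {m} → ∣ τ ∣ ≡ suc m → Nonempty τ
card>0⇒nonempty {τ = true ∷ τ}  eq = zero , here
card>0⇒nonempty {τ = false ∷ τ} eq with x , x∈ ← card>0⇒nonempty {τ = τ} eq = suc x , there x∈

module _ (I : GBNInstance) where

  open GBNInstance I using (K; r; dimension; isBetti) renaming (betti to b)
  open MinProblem GlobalBoundaryNontrivialization using (encode; size; IsApproximation)
  open Coboundary K r
  open Encoding K

  top-simplex : ∃[ σ ] σ ∈ top
  top-simplex with σ , σ∈ , dσ ← find (proj₂ dimension) =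
    σ , ∈-simplicesOfDim⁺ {K = K} σ∈ (trans (sym (suc-pred _ {{>-nonZero (nonempty⇒card>0 (All.lookup (nonempty K) σ∈))}})) (cong suc dσ))

  row-exists : ∃[ i ] i ∈ rows
  row-exists with σ , σ∈ ← top-simplex with σ∈K , card ← ∈-simplicesOfDim⁻ {K = K} σ∈
    with τ , τ⊆ , cardτ ← facet-exists (All.lookup (nonempty K) σ∈K)
    with i , i∈ , _ ← facet-row σ∈ (card>0⇒nonempty (suc-injective (trans (sym cardτ) card)) , τ⊆ , cardτ) = i , i∈

  2^[2+r]≤1+n : 2 ^ (2 + r) ≤ suc (n I)
  2^[2+r]≤1+n with σ , σ∈ ← top-simplex with σ∈K , card ← ∈-simplicesOfDim⁻ {K = K} σ∈ =
    subst (λ c → 2 ^ c ≤ suc (n I)) card (2^card≤1+#simplices K σ∈K)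

  2+r≤n : 2 + r ≤ n I
  2+r≤n = ≤-pred (≤-trans (1+n≤2^n (2 + r)) 2^[2+r]≤1+n)

  1+r≤log : suc r ≤ ⌊log₂ n I ⌋
  1+r≤log = ≤-trans (≤-reflexive (sym (⌊log₂[2^n]⌋≡n (suc r)))) (⌊log₂⌋-mono-≤ (≤-pred (≤-trans half≤ 2^[2+r]≤1+n)))
    where
    half≤ : suc (2 ^ suc r) ≤ 2 ^ (2 + r)
    half≤ = ≤-trans (+-monoˡ-≤ (2 ^ suc r) (m^n>0 2 (suc r))) (≤-reflexive (cong (2 ^ suc r +_) (sym (+-identityʳ _))))

  module _ (W : ℕ) (W≥ : 2 * (2 ^ β I * size I) ≤ W) where

    1≤P : 1 ≤ 2 ^ β I
    1≤P = m^n>0 2 (β I)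

    2+n≤size : 2 + n I ≤ size I
    2+n≤size = s≤s (s≤s (≤-trans (≤-reflexive (sym (length-tabulate (λ i → i)))) (length≤records indices)))

    X≤W : 2 * size I ≤ W
    X≤W = ≤-trans (*-monoʳ-≤ 2 (≤-trans (≤-reflexive (sym (*-identityˡ _))) (*-monoˡ-≤ (size I) 1≤P))) W≥

    size≤W : size I ≤ W
    size≤W = ≤-trans (m≤m+n (size I) _) X≤W

    n<W : n I < W
    n<W = ≤-trans (≤-trans (n≤1+n _) 2+n≤size) size≤W

    2[2+r]≤W : 2 + r + (2 + r) ≤ W
    2[2+r]≤W = ≤-trans (+-mono-≤ r≤ (≤-trans r≤ (≤-reflexive (sym (+-identityʳ (size I)))))) X≤W
      where
      r≤ : 2 + r ≤ size I
      r≤ = ≤-trans 2+r≤n (≤-trans (m≤n+m _ 2) 2+n≤size)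

    dims : ∀ i → dim σ[ i ] + r ≤ W
    dims i = ≤-trans (+-mono-≤ (≤-trans (All.lookup (proj₁ dimension) (σ∈K i)) (n≤1+n _)) (m≤n+m r 2)) 2[2+r]≤W

    zeros : ∀ {a} → size I ≤ a → nth (encode I) a ≡ 0
    zeros = nth-beyond (encode I)
      where
      nth-beyond : ∀ xs {a} → length xs ≤ a → nth xs a ≡ 0
      nth-beyond []       _       = refl
      nth-beyond (x ∷ xs) (s≤s p) = nth-beyond xs p

    open Machine K r W
    open Search K r W dims n<W
    open Execution K r W dims n<W (nth (encode I)) zeros (segment-intro 2 (records indices) (λ _ → refl)) size≤W

    -- The bounds needed for the enumeration, from q ≤ b.
    few : (∀ {i} → i ∈ rows → 2 * (2 + r) < length (cofacetIndices i)) →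
      inputEnd + 2 ^ length rows * (n₀ + n₀) ≤ W × enumerateTime ≤ 5 + n I * 3 + 2 ^ β I * β I * n I * 43
    few many = ≤-trans (≤-trans (+-mono-≤ size≤ pow≤) (≤-reflexive (cong (2 ^ β I * size I +_) (sym (+-identityʳ _))))) W≥ ,
      enumeration-cost {b = b} {P = 2 ^ β I} (≤-trans (s≤s z≤n) 2+r≤n) length-rows q≤b (^-monoʳ-≤ 2 (≤-trans q≤b (m≤m+n b 1)))
      where
      q≤b : length rows ≤ b
      q≤b = rows-few (proj₁ dimension) isBetti many
      size≤ : size I ≤ 2 ^ β I * size I
      size≤ = ≤-trans (≤-reflexive (sym (*-identityˡ _))) (*-monoˡ-≤ (size I) 1≤P)
      regroup : ∀ p m → p * (m + m) ≡ p * 2 * m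
      regroup = solve-∀
      pow≤ : 2 ^ length rows * (n I + n I) ≤ 2 ^ β I * size I
      pow≤ = ≤-trans (≤-reflexive (regroup (2 ^ length rows) (n I))) (*-mono-≤
        (≤-trans (*-monoˡ-≤ 2 (^-monoʳ-≤ 2 q≤b)) (≤-reflexive (sym (^-distribˡ-+-* 2 b 1)))) (≤-trans (m≤n+m _ 2) 2+n≤size))

    -- The approximation factor: 2 (r + 2) ≤ 4 (r + 1), and r + 1 ≤ log₂ n.
    ratio : ℕ
    ratio = 4 * ⌊log₂ n I ⌋

    approximation : ∀ {s v h} → Represents s v h → Outcome v h → IsApproximation I ratio (output s)
    approximation {s} (represents r≗ h≗) (a , l , w , refl , (is , refl , stored , sol) , quality) =
      subst (IsApproximation I ratio) (sym out≡) ((is , refl , sol) , bound)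
      where
      out≡ : output s ≡ map toℕ is
      out≡ = trans (cong₂ (λ a l → applyUpTo (λ i → heap s (a + i)) l) (r≗ 0) (trans (r≗ 1) (sym (length-map toℕ is))))
        (segment-output a (map toℕ is) (segment-frame (map toℕ is) (λ _ → h≗ _) ≤-refl stored))
      1≤ratio : 1 ≤ ratio
      1≤ratio = ≤-trans (≤-trans (s≤s z≤n) 1+r≤log) (m≤n*m _ 4)
      bound : ∀ S* → MinProblem.IsOptimal GlobalBoundaryNontrivialization I S* → length (map toℕ is) ≤ ratio * length S*
      bound _ ((is* , refl , sol*) , _) = begin
        length (map toℕ is)             ≡⟨ length-map toℕ is ⟩
        length is                       ≤⟨ [ logarithmic , minimum ]′ quality ⟩
        ratio * length is*              ≡⟨ cong (ratio *_) (length-map toℕ is*) ⟨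
        ratio * length (map toℕ is*)    ∎
        where
        open ≤-Reasoning
        minimum : Minimum (length is) → length is ≤ ratio * length is*
        minimum min = ≤-trans (solution-bound min is* sol*) (m≤n*m _ ratio {{>-nonZero 1≤ratio}})
        regroup : ∀ r → 2 * (2 + r) + r * 2 ≡ 4 * suc r
        regroup = solve-∀
        logarithmic : LogSmall (length is) → length is ≤ ratio * length is*
        logarithmic small = ≤-trans small (≤-trans (≤-trans (m≤m+n _ (r * 2)) (≤-trans (≤-reflexive (regroup r)) (*-monoʳ-≤ 4 1+r≤log)))
          (m≤m*n ratio (length is*) {{>-nonZero (solution-nonempty is* sol*)}}))

    execution : ∃[ t ] ∃[ s ] (W ⊢ algorithm , initial (encode I) [] ⇓[ t ] s) ×
                t ≤ 100 * (2 ^ β I * β I * n I) × IsApproximation I ratio (output s)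
    execution = let t , s , d , t≤ , ρ = Run.exec run (represents (λ _ → refl) (λ _ → refl)) in
      t , s , d , ≤-trans t≤ (algorithm-cost {b = b} {P = 2 ^ β I} (≤-trans (s≤s z≤n) 2+r≤n) length-rows 1≤P) , approximation ρ (Run.post run)
      where
      run = algorithm-run {TE = 5 + n I * 3 + 2 ^ β I * β I * n I * 43} refl refl row-exists 2[2+r]≤W (s≤s z≤n) few

open MinProblem GlobalBoundaryNontrivialization using (size)

-- The word bound is large enough for the execution, with 100 · 4 ^ β as the factor
-- that depends on the parameter.
fpt-words : ∀ I → 2 * (2 ^ β I * size I) ≤ 100 * 4 ^ β I * size I ^ 1
fpt-words I = ≤-trans (≤-reflexive (sym (*-assoc 2 (2 ^ β I) (size I))))
  (*-mono-≤ (*-mono-≤ {2} {100} (s≤s (s≤s z≤n)) (^-monoˡ-≤ (β I) {2} {4} (s≤s (s≤s z≤n)))) (≤-reflexive (sym (*-identityʳ (size I)))))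

fpt-time : ∀ I → 100 * (2 ^ β I * β I * n I) ≤ 100 * 4 ^ β I * size I ^ 1
fpt-time I = ≤-trans (*-monoʳ-≤ 100 (*-mono-≤ (≤-trans (*-monoʳ-≤ (2 ^ β I) (≤-trans (n≤1+n _) (1+n≤2^n (β I)))) (≤-reflexive (square (β I)))) n≤size))
  (≤-reflexive (trans (sym (*-assoc 100 (4 ^ β I) (size I))) (cong (100 * 4 ^ β I *_) (sym (*-identityʳ (size I))))))
  where
  n≤size : n I ≤ size I
  n≤size = ≤-trans (m≤n+m _ 2) (2+n≤size I (2 * (2 ^ β I * size I)) ≤-refl)
  square : ∀ k → 2 ^ k * 2 ^ k ≡ 4 ^ k
  square zero    = refl
  square (suc k) = trans (regroup (2 ^ k)) (cong (4 *_) (square k))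
    where
    regroup : ∀ x → 2 * x * (2 * x) ≡ 4 * (x * x)
    regroup = solve-∀

-- The exponent 100 also serves as the constant in the time bound; 2 suffices for
-- the words.
ram-words : ∀ I → 2 * (2 ^ β I * size I) ≤ (2 ^ β I * size I) ^ 100
ram-words I = ≤-trans (≤-trans (*-monoˡ-≤ X 2≤X) (≤-reflexive (cong (X *_) (sym (*-identityʳ X)))))
  (^-monoʳ-≤ X {{>-nonZero (≤-trans (s≤s z≤n) 2≤X)}} {2} {100} (s≤s (s≤s z≤n)))
  where
  X : ℕ
  X = 2 ^ β I * size I
  2≤X : 2 ≤ X
  2≤X = *-mono-≤ {1} {2 ^ β I} {2} (m^n>0 2 (β I)) (s≤s (s≤s z≤n))

corollary74 : ∃[ P ] ∃[ C ]
    IsRandomizedFPTApprox GlobalBoundaryNontrivialization β (λ I → C * ⌊log₂ n I ⌋) P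
    × RunsInTimeO GlobalBoundaryNontrivialization β (λ I → 2 ^ β I * β I * n I * (n I ⊓ 2 ^ β I)) P
corollary74 = algorithm , 4 ,
  record
    { f = λ k → 100 * 4 ^ k
    ; f-computable = power-computable
    ; k = 1
    ; correct = λ I → let t , s , d , t≤ , approx = execution I (100 * 4 ^ β I * size I ^ 1) (fpt-words I) in
        0 , (λ { [] → t , s , d , ≤-trans t≤ (fpt-time I) }) ,
        ([] ∷ []) , ([] ∷ []) , s≤s z≤n , ((t , s , d , approx) ∷ [])
    } ,
  100 , λ I → 0 , λ { [] →
    let t , s , d , t≤ , _ = execution I ((2 ^ β I * size I) ^ 100) (ram-words I) in
    t , s , d , ≤-trans t≤ (*-monoʳ-≤ 100 (m≤m*n (2 ^ β I * β I * n I) (n I ⊓ 2 ^ β I) {{>-nonZero (⊓-glb (≤-trans (s≤s z≤n) (2+r≤n I)) (m^n>0 2 (β I)))}})) }
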